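{- Let $\mathcal{H}$ be a countable family of simple graphs of bounded minimum branching core size, i.e. $\{\underline{\mathrm{bc}}(H):H\in\mathcal{H}\}$ is bounded. Then $\mathcal{H}$ can be partitioned into finitely many subsets $\mathcal{H}_\ell$, $1\le\ell\le m$, each indexed as $\mathcal{H}_\ell=(H_{\mathbf{k}_\ell}:\mathbf{k}_\ell\in I_\ell)$ for some $I_\ell\subseteq\mathbb{N}^{h_\ell}$ ($h_\ell\ge1$), such that for each $\ell$: (i) there is a rooted tree $T_\ell$ with $|V(T_\ell)|=h_\ell$ and a fixed graph $G_\ell\subseteq\mathrm{clos}(T_\ell)$ (spanning subgraph) such that $H_{\mathbf{k}_\ell}=T_\ell^{\mathbf{k}_\ell}(G_\ell)$ for every $\mathbf{k}_\ell\in I_\ell$; and (ii) $(H_{\mathbf{k}_\ell})$, indexed by $\mathbf{k}_\ell\in I_\ell$, is a strongly polynomial subsequence.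
   Context: Graphs are finite; $\mathrm{hom}(G,H)$ is the number of homomorphisms from $G$ to $H$. $\mathbb{N}$ denotes the positive integers. A sequence $(H_{\mathbf{k}})$ indexed by all $\mathbf{k}\in\mathbb{N}^h$ is strongly polynomial if for every graph $G$ there is a polynomial $p(G;x_1,\dots,x_h)$ with $\mathrm{hom}(G,H_{\mathbf{k}})=p(G;\mathbf{k})$ for all $\mathbf{k}$. A sequence $(F_{\mathbf{k}})$ indexed by $I\subseteq\mathbb{N}^h$ is a strongly polynomial subsequence if there is a strongly polynomial sequence $(H_{\mathbf{k}})_{\mathbf{k}\in\mathbb{N}^h}$ with $H_{\mathbf{k}}=F_{\mathbf{k}}$ for $\mathbf{k}\in I$. Rooted trees: for a rooted tree $T$ with root $r$, $P(s)$ is the vertex set of the path from $r$ to $s$ (including both); $t\ne s$ is an ancestor of $s$ if $t\in P(s)$; the level of $s$ is $|P(s)|-1$. $\mathrm{clos}(T)$ is the simple graph on $V(T)$ with $s\ne t$ adjacent iff one is an ancestor of the other. Branching: for $\mathbf{k}=(k_s)_{s\in V(T)}\in\mathbb{N}^{|V(T)|}$, $T^{\mathbf{k}}$ is the rooted forest whose vertices are pairs $(s,\varphi)$ with $s\in V(T)$ and $\varphi$ assigning to each $t\in P(s)$ an element of $\{1,\dots,k_t\}$, where $(t,\psi)$ is an ancestor of $(s,\varphi)$ iff $t$ is an ancestor of $s$ and $\psi=\varphi|_{P(t)}$. For a spanning subgraph $G$ of $\mathrm{clos}(T)$, $T^{\mathbf{k}}(G)$ is the simple graph on $V(T^{\mathbf{k}})$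 where $(s,\varphi)$ and an ancestor $(t,\psi)$ (so $\psi=\varphi|_{P(t)}$) are adjacent iff $st\in E(G)$, and there are no other edges. Minimum branching core size: given a simple graph $H$ and a rooted tree $T$ with $V(T)=V(H)$ such that $H$ is a spanning subgraph of $\mathrm{clos}(T)$, colour each $s\in V(T)$ by $A_s=\{\text{level of }t: t\text{ an ancestor of }s,\ st\in E(H)\}$. The branching core size $\mathrm{bc}(T)$ is the number of orbits on $V(T)$ of the group of root- and colour-preserving automorphisms of the rooted tree $T$ (equivalently, the number of vertices left after repeatedly merging colour-isomorphic subtrees hanging from a common parent). $\underline{\mathrm{bc}}(H)$ is the minimum of $\mathrm{bc}(T)$ over all such rooted trees $T$. -}

module Defs where

open import Data.Nat using (ℕ; zero; suc; _≤_; _<_; _^_)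
open import Data.Fin using (Fin)
open import Data.Bool using (Bool; true; false; _∧_; _∨_; not)
open import Data.List using (List; []; _∷_; map; concatMap; filter; length; foldr)
open import Data.List as List using (allFin)
open import Data.Vec.Functional as VF using ()
open import Data.Product using (Σ; ∃; ∃-syntax; _×_; _,_)
open import Data.Sum using (_⊎_)
open import Data.Integer using (+_)
open import Data.Rational using (ℚ; _/_; 0ℚ; 1ℚ) renaming (_+_ to _+ℚ_; _*_ to _*ℚ_)
open import Relation.Nullary using (¬_)
open import Relation.Binary.PropositionalEquality using (_≡_; _≢_)

record SGraph (n : ℕ) : Set where
  field
    adj    : Fin n → Fin n → Bool
    sym    : ∀ i j → adj i j ≡ adj j i
    irrefl : ∀ i → adj i i ≡ false
open SGraph public

Graph : Set
Graph = Σ ℕ SGraph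

vtx : Graph → ℕ
vtx (n , _) = n

GIso : Graph → Graph → Set
GIso (n , A) (n' , B) =
  Σ (Fin n → Fin n') λ f → Σ (Fin n' → Fin n) λ g →
    (∀ x → g (f x) ≡ x) × (∀ y → f (g y) ≡ y) ×
    (∀ x y → adj A x y ≡ adj B (f x) (f y))

allFuns : (a b : ℕ) → List (Fin a → Fin b)
allFuns zero    b = (λ ()) ∷ []
allFuns (suc a) b = concatMap (λ x → map (λ f → x VF.∷ f) (allFuns a b)) (allFin b)

andL : List Bool → Bool
andL = foldr _∧_ true

isHom : ∀ {a b} → SGraph a → SGraph b → (Fin a → Fin b) → Bool
isHom {a} G H f =
  andL (concatMap (λ i → map (λ j → not (adj G i j) ∨ adj H (f i) (f j)) (allFin a)) (allFin a))

hom : Graph → Graph → ℕ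
hom (a , G) (b , H) = length (filter (λ f → isHom G H f Data.Bool.≟ true) (allFuns a b))
  where import Data.Bool

-- Index vectors in ℕ^h (ℕ = positive integers) and multivariate polynomials

Vecℕ : ℕ → Set
Vecℕ h = Fin h → ℕ

Pos : ∀ {h} → Vecℕ h → Set
Pos k = ∀ i → 1 ≤ k i

toℚ : ℕ → ℚ
toℚ n = + n / 1

prodFin : ∀ {h} → (Fin h → ℚ) → ℚ
prodFin {zero}  f = 1ℚ
prodFin {suc h} f = f Fin.zero *ℚ prodFin (λ i → f (Fin.suc i))
  where import Data.Fin as Fin

Poly : ℕ → Set
Poly h = List (ℚ × Vecℕ h)

evalPoly : ∀ {h} → Poly h → Vecℕ h → ℚ
evalPoly []              x = 0ℚ
evalPoly ((c , e) ∷ ms) x = (c *ℚ prodFin (λ i → toℚ (x i ^ e i))) +ℚ evalPoly ms x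

StronglyPolynomial : (h : ℕ) → ((k : Vecℕ h) → Pos k → Graph) → Set
StronglyPolynomial h J =
  (G : Graph) → Σ (Poly h) λ p → ∀ k (pk : Pos k) → toℚ (hom G (J k pk)) ≡ evalPoly p k

iter : ∀ {A : Set} → (A → A) → ℕ → A → A
iter f zero    x = x
iter f (suc j) x = iter f j (f x)

record RootedTree (h : ℕ) : Set where
  field
    root        : Fin h
    parent      : Fin h → Fin h
    parent-root : parent root ≡ root
    reaches     : ∀ s → iter parent h s ≡ root
open RootedTree public

InPath : ∀ {h} → RootedTree h → Fin h → Fin h → Set
InPath T t s = ∃[ j ] iter (parent T) j s ≡ t

Ancestor : ∀ {h} → RootedTree h → Fin h → Fin h → Set
Ancestor T t s = InPath T t s × t ≢ s

IsLevel : ∀ {h} → RootedTree h → Fin h → ℕ → Set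
IsLevel T s ℓ = (iter (parent T) ℓ s ≡ root T) × (∀ j → j < ℓ → iter (parent T) j s ≢ root T)

SubClos : ∀ {h} → RootedTree h → SGraph h → Set
SubClos T G = ∀ s t → adj G s t ≡ true → Ancestor T s t ⊎ Ancestor T t s

InColour : ∀ {h} → RootedTree h → SGraph h → Fin h → ℕ → Set
InColour T H s ℓ = ∃[ t ] Ancestor T t s × adj H s t ≡ true × IsLevel T t ℓ

record Aut {h} (T : RootedTree h) (H : SGraph h) : Set where
  field
    σ       : Fin h → Fin h
    σ⁻¹     : Fin h → Fin h
    inv₁    : ∀ s → σ⁻¹ (σ s) ≡ s
    inv₂    : ∀ s → σ (σ⁻¹ s) ≡ s
    σ-root  : σ (root T) ≡ root T
    σ-par   : ∀ s → parent T (σ s) ≡ σ (parent T s)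
    σ-col   : ∀ s ℓ → (InColour T H (σ s) ℓ → InColour T H s ℓ) × (InColour T H s ℓ → InColour T H (σ s) ℓ)

SameOrbit : ∀ {h} → RootedTree h → SGraph h → Fin h → Fin h → Set
SameOrbit T H s t = Σ (Aut T H) λ a → Aut.σ a s ≡ t

-- bc(T) = b : there are exactly b orbits, witnessed by a system of
-- b representatives lying in pairwise distinct orbits and covering all orbits
IsBc : ∀ {h} → RootedTree h → SGraph h → ℕ → Set
IsBc {h} T H b = Σ (Fin b → Fin h) λ rep →
  (∀ i j → SameOrbit T H (rep i) (rep j) → i ≡ j) ×
  (∀ s → ∃[ i ] SameOrbit T H (rep i) s)

MinBcAtMost : Graph → ℕ → Set
MinBcAtMost (n , H) B = Σ (RootedTree n) λ T → SubClos T H × (∃[ b ] IsBc T H b × b ≤ B)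

-- vertices (s , φ) of T^k : φ t ∈ {1..k_t} for t ∈ P(s), and φ t = 0 (unused) otherwise
BVertex : ∀ {h} → RootedTree h → Vecℕ h → Set
BVertex {h} T k = Σ (Fin h) λ s → Σ (Vecℕ h) λ φ →
  (∀ t → InPath T t s → 1 ≤ φ t × φ t ≤ k t) × (∀ t → ¬ InPath T t s → φ t ≡ 0)

BEq : ∀ {h} {T : RootedTree h} {k : Vecℕ h} → BVertex T k → BVertex T k → Set
BEq (s , φ , _) (s' , φ' , _) = (s ≡ s') × (∀ t → φ t ≡ φ' t)

-- (t , ψ) is an ancestor of (s , φ) in T^k (ψ = φ restricted to P(t)) and st ∈ E(G)
BAdjUp : ∀ {h} (T : RootedTree h) → SGraph h → (k : Vecℕ h) → BVertex T k → BVertex T k → Set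
BAdjUp T G k (s , φ , _) (t , ψ , _) =
  Ancestor T t s × adj G s t ≡ true × (∀ u → InPath T u t → ψ u ≡ φ u)

BAdj : ∀ {h} (T : RootedTree h) → SGraph h → (k : Vecℕ h) → BVertex T k → BVertex T k → Set
BAdj T G k v w = BAdjUp T G k v w ⊎ BAdjUp T G k w v

IsoBranch : Graph → ∀ {h} → RootedTree h → SGraph h → Vecℕ h → Set
IsoBranch (n , H) T G k =
  Σ (Fin n → BVertex T k) λ f → Σ (BVertex T k → Fin n) λ g →
    (∀ x → g (f x) ≡ x) × (∀ v → BEq {T = T} {k = k} (f (g v)) v) ×
    (∀ v w → BEq {T = T} {k = k} v w → g v ≡ g w) ×
    (∀ x y → (adj H x y ≡ true → BAdj T G k (f x) (f y)) × (BAdj T G k (f x) (f y) → adj H x y ≡ true))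

StronglyPolySub : ∀ {h} → RootedTree h → SGraph h → (Vecℕ h → Set) → Set
StronglyPolySub {h} T G I = Σ ((k : Vecℕ h) → Pos k → Graph) λ J →
  StronglyPolynomial h J × (∀ k (pk : Pos k) → I k → IsoBranch (J k pk) T G k)

{-# OPTIONS --safe #-}

-- Let T be a tree on H with at most B orbits. Identifying the vertices in each orbit gives a tree T' on
-- at most B vertices and a graph G' ⊆ clos(T'), and numbering the children of a vertex within their
-- orbit identifies H with T'^k(G'), where k_i is the number of children in the orbit i of a vertex in the
-- parent orbit. There are only finitely many pairs (T', G') with at most B vertices. Isomorphic members
-- of the family receive the same pair and the same k because each graph takes those of the first member
-- of the family isomorphic to it.
--
-- A homomorphism X → T^k(G) is a homomorphism s : X → G together with, for every t, a labelling of
-- {x : t ∈ P(s x)} by {1,…,k_t} that is constant along the edges of X. If c(s,t) is the number of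
-- connected components of that set, then hom(X, T^k(G)) = Σ_s Π_t k_t^c(s,t).

module Submission where

open import Defs renaming (sym to adj-sym)
import Data.Bool as Bool
open import Data.Bool using (Bool; true; false; if_then_else_; not; _∨_)
open import Data.Empty using (⊥-elim)
open import Data.Fin using (Fin; zero; suc; toℕ; fromℕ<; splitAt; join; combine; remQuot; punchIn; punchOut; _≟_)
open import Data.Fin.Properties using (injective⇒≤; splitAt-join; join-splitAt; combine-remQuot; remQuot-combine; toℕ-injective; toℕ<n; toℕ-fromℕ<; any?; all?; pigeonhole; punchIn-punchOut; punchOut-punchIn; punchInᵢ≢i; punchOut-cong)
import Data.Integer as ℤ
import Data.Integer.Properties as ℤ
open import Data.List using (List; []; _∷_; map; concatMap; _++_; allFin; tabulate; filter; length; lookup; upTo)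
open import Data.List.Membership.Propositional.Properties using (∈-upTo⁺)
open import Data.List.Properties using (map-++; map-tabulate; map-∘; map-cong)
open import Data.List.Relation.Unary.All as All using (All; []; _∷_)
import Data.List.Relation.Unary.All.Properties as All
open import Data.List.Relation.Unary.Any as Any using (Any; here; there)
import Data.List.Relation.Unary.Any.Properties as Any
open import Data.Maybe using (Maybe; just; nothing; maybe′; _>>=_)
import Data.Maybe.Properties as Maybe
open import Data.Nat using (ℕ; zero; suc; _+_; _*_; _∸_; _^_; _≤_; _<_; z≤n; s≤s; s≤s⁻¹)
import Data.Nat as ℕ
open import Data.Nat.ListAction using (sum)
open import Data.Nat.ListAction.Properties using (sum-++)
open import Data.Nat.Properties using (≤-refl; ≤-trans; ≤-antisym; ≤-total; <⇒≤; ≰⇒>; <-cmp; n<1+n; suc-injective; +-identityʳ; +-suc; m≤n+m; m≤m*n; m∸n≤m; m≤n+m∸n; m+[n∸m]≡n)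
open import Data.Product using (Σ; ∃-syntax; _×_; _,_; proj₁; proj₂)
open import Data.Product.Relation.Binary.Pointwise.NonDependent using (×-isEquivalence) renaming (Pointwise to _×ᴿ_)
open import Data.Rational using (0ℚ; 1ℚ; toℚᵘ) renaming (_+_ to _+ℚ_; _*_ to _*ℚ_)
import Data.Rational.Properties as ℚ
open import Data.Rational.Unnormalised using (mkℚᵘ; *≡*) renaming (_≃_ to _≃ᵘ_)
import Data.Rational.Unnormalised.Properties as ℚᵘ
open import Data.Sum using (_⊎_; inj₁; inj₂; [_,_]′)
open import Data.Unit using (⊤; tt)
open import Data.Vec.Functional as VF using ()
open import Data.Vec.Functional.Relation.Binary.Pointwise using (Pointwise)
import Data.Vec.Functional.Relation.Binary.Pointwise.Properties as Pointwise
open import Function using (_∘_; id; mk⇔)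
open import Relation.Binary using (IsEquivalence; tri<; tri≈; tri>)
open import Relation.Binary.PropositionalEquality using (_≡_; _≢_; refl; sym; trans; cong; cong₂; subst; subst₂) renaming (isEquivalence to ≡-eq)
open import Relation.Nullary using (¬_; Dec; yes; no; does; contradiction)
open import Relation.Nullary.Decidable using (does-⇔; dec-true; dec-false; _×-dec_; _⊎-dec_; _→-dec_; ¬?; map′)

-- Counting up to an equivalence relation

-- Most of the objects counted are functions, which are identified when they agree pointwise; so `P`
-- has `n` elements up to `_≈_`, each class being listed once.
record Card {A : Set} (_≈_ : A → A → Set) (P : A → Set) (n : ℕ) : Set where
  field
    at      : Fin n → A
    at-P    : ∀ i → P (at i)
    at-inj  : ∀ i j → at i ≈ at j → i ≡ j
    at-surj : ∀ a → P a → ∃[ i ] at i ≈ a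
open Card

_≋_ : ∀ {A : Set} {n} → (Fin n → A) → (Fin n → A) → Set
f ≋ g = ∀ i → f i ≡ g i

≋-eq : ∀ {A : Set} {n} → IsEquivalence (_≋_ {A} {n})
≋-eq = Pointwise.isEquivalence ≡-eq _

card-map : ∀ {A B : Set} {_≈₁_ : A → A → Set} {_≈₂_ : B → B → Set} {P : A → Set} {Q : B → Set} {n} →
  IsEquivalence _≈₂_ → (g : A → B) →
  (∀ {a a'} → a ≈₁ a' → g a ≈₂ g a') →
  (∀ {a} → P a → Q (g a)) →
  (∀ {a a'} → P a → P a' → g a ≈₂ g a' → a ≈₁ a') →
  (∀ b → Q b → ∃[ a ] P a × (g a ≈₂ b)) →
  Card _≈₁_ P n → Card _≈₂_ Q n
card-map e g g-cong sound inj surj C = record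
  { at = g ∘ at C
  ; at-P = λ i → sound (at-P C i)
  ; at-inj = λ i j p → at-inj C i j (inj (at-P C i) (at-P C j) p)
  ; at-surj = λ b q → let (a , pa , ga≈b) = surj b q ; (i , p) = at-surj C a pa in
                      i , IsEquivalence.trans e (g-cong p) ga≈b }

-- Sending each listed element to its position in the other list is injective.
card-≤ : ∀ {A : Set} {_≈_ : A → A → Set} {P : A → Set} {n m} → IsEquivalence _≈_ →
  Card _≈_ P n → Card _≈_ P m → n ≤ m
card-≤ {_≈_ = _≈_} {n = n} {m} e C D = injective⇒≤ {f = f} λ {i} {j} p →
  at-inj C i j (E.trans (E.sym (f≈ i)) (subst (λ z → at D z ≈ at C j) (sym p) (f≈ j)))
  where
  module E = IsEquivalence e
  f : Fin n → Fin m
  f i = proj₁ (at-surj D (at C i) (at-P C i))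
  f≈ : ∀ i → at D (f i) ≈ at C i
  f≈ i = proj₂ (at-surj D (at C i) (at-P C i))

card-unique : ∀ {A : Set} {_≈_ : A → A → Set} {P : A → Set} {n m} → IsEquivalence _≈_ →
  Card _≈_ P n → Card _≈_ P m → n ≡ m
card-unique e C D = ≤-antisym (card-≤ e C D) (card-≤ e D C)

-- Disjointness is asked in both orders because `_≈_` is not assumed symmetric here.
card-⊎ : ∀ {A : Set} {_≈_ : A → A → Set} {P Q : A → Set} {n m} →
  (∀ {a b} → P a → Q b → ¬ (a ≈ b)) → (∀ {a b} → P a → Q b → ¬ (b ≈ a)) →
  Card _≈_ P n → Card _≈_ Q m → Card _≈_ (λ a → P a ⊎ Q a) (n + m)
card-⊎ {A} {_≈_} {P} {Q} {n} {m} disj disj' C D = record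
  { at = at' ∘ splitAt n
  ; at-P = λ i → P' (splitAt n i)
  ; at-inj = λ i j p → trans (sym (join-splitAt n m i)) (trans (cong (join n m) (inj' (splitAt n i) (splitAt n j) p)) (join-splitAt n m j))
  ; at-surj = λ { a (inj₁ p) → let (i , q) = at-surj C a p in
                               join n m (inj₁ i) , subst (λ z → at' z ≈ a) (sym (splitAt-join n m (inj₁ i))) q
                ; a (inj₂ p) → let (i , q) = at-surj D a p in
                               join n m (inj₂ i) , subst (λ z → at' z ≈ a) (sym (splitAt-join n m (inj₂ i))) q } }
  where
  at' : Fin n ⊎ Fin m → A
  at' = [ at C , at D ]′
  P' : ∀ z → P (at' z) ⊎ Q (at' z)
  P' (inj₁ i) = inj₁ (at-P C i)
  P' (inj₂ i) = inj₂ (at-P D i)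
  inj' : ∀ y z → at' y ≈ at' z → y ≡ z
  inj' (inj₁ i) (inj₁ j) p = cong inj₁ (at-inj C i j p)
  inj' (inj₁ i) (inj₂ j) p = ⊥-elim (disj (at-P C i) (at-P D j) p)
  inj' (inj₂ i) (inj₁ j) p = ⊥-elim (disj' (at-P C j) (at-P D i) p)
  inj' (inj₂ i) (inj₂ j) p = cong inj₂ (at-inj D i j p)

card-× : ∀ {A B : Set} {_≈₁_ : A → A → Set} {_≈₂_ : B → B → Set} {P : A → Set} {Q : B → Set} {n m} →
  Card _≈₁_ P n → Card _≈₂_ Q m →
  Card (_≈₁_ ×ᴿ _≈₂_) (λ (a , b) → P a × Q b) (n * m)
card-× {A} {B} {_≈₁_} {_≈₂_} {n = n} {m} C D = record
  { at = at' ∘ remQuot m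
  ; at-P = λ i → at-P C (proj₁ (remQuot m i)) , at-P D (proj₂ (remQuot {n} m i))
  ; at-inj = λ i j (p , q) → trans (sym (combine-remQuot {n} m i)) (trans (cong₂ combine (at-inj C _ _ p) (at-inj D _ _ q)) (combine-remQuot {n} m j))
  ; at-surj = λ (a , b) (p , q) → let (i , u) = at-surj C a p ; (j , v) = at-surj D b q in
      combine i j , subst (λ z → (_≈₁_ ×ᴿ _≈₂_) (at' z) (a , b)) (sym (remQuot-combine i j)) (u , v) }
  where
  at' : Fin n × Fin m → A × B
  at' (i , j) = at C i , at D j

card-empty : ∀ {A : Set} {_≈_ : A → A → Set} {P : A → Set} → (∀ a → ¬ P a) → Card _≈_ P 0
card-empty np = record { at = λ () ; at-P = λ () ; at-inj = λ () ; at-surj = λ a p → ⊥-elim (np a p) }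

card-one : ∀ {A : Set} {_≈_ : A → A → Set} {P : A → Set} (a : A) → P a → (∀ b → P b → a ≈ b) → Card _≈_ P 1
card-one a p u = record { at = λ _ → a ; at-P = λ _ → p ; at-inj = λ { zero zero _ → refl } ; at-surj = λ b q → zero , u b q }

card-interval : ∀ k → Card _≡_ (λ v → 1 ≤ v × v ≤ k) k
card-interval k = record
  { at = suc ∘ toℕ
  ; at-P = λ i → s≤s z≤n , toℕ<n i
  ; at-inj = λ i j p → toℕ-injective (suc-injective p)
  ; at-surj = λ { (suc v) (_ , v<k) → fromℕ< v<k , cong suc (toℕ-fromℕ< v<k) } }

sumF : ∀ {b} → (Fin b → ℕ) → ℕ
sumF {zero}  n = 0
sumF {suc b} n = n zero + sumF (n ∘ suc)

prodF : ∀ {b} → (Fin b → ℕ) → ℕ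
prodF {zero}  n = 1
prodF {suc b} n = n zero * prodF (n ∘ suc)

prodF-const : ∀ c k → prodF {c} (λ _ → k) ≡ k ^ c
prodF-const zero    k = refl
prodF-const (suc c) k = cong (k *_) (prodF-const c k)

card-Σ : ∀ b {Y : Set} {_≈_ : Y → Y → Set} → IsEquivalence _≈_ → (P : Fin b → Y → Set) (n : Fin b → ℕ) →
  (∀ x → Card _≈_ (P x) (n x)) → Card (_≡_ ×ᴿ _≈_) (λ (x , y) → P x y) (sumF n)
card-Σ zero    e P n C = card-empty λ ()
card-Σ (suc b) {Y} {_≈_} e P n C =
  card-map (×-isEquivalence ≡-eq e) id id
    (λ { {a} (inj₁ (refl , q)) → q ; {a} (inj₂ (x , refl , q)) → q })
    (λ _ _ r → r)
    (λ { (zero , y) p → _ , inj₁ (refl , p) , (refl , E.refl) ; (suc x , y) p → _ , inj₂ (x , refl , p) , (refl , E.refl) })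
    (card-⊎ {P = λ (x , y) → x ≡ zero × P x y} {Q = λ (x , y) → ∃[ x' ] x ≡ suc x' × P x y}
       (λ { (refl , _) (_ , refl , _) (() , _) }) (λ { (refl , _) (_ , refl , _) (() , _) }) C0 CS)
  where
  module E = IsEquivalence e
  C0 : Card (_≡_ ×ᴿ _≈_) (λ (x , y) → x ≡ zero × P x y) (n zero)
  C0 = card-map (×-isEquivalence ≡-eq e) (zero ,_) (refl ,_) (refl ,_) (λ _ _ → proj₂)
         (λ { (zero , y) (_ , p) → y , p , (refl , E.refl) }) (C zero)
  CS : Card (_≡_ ×ᴿ _≈_) (λ (x , y) → ∃[ x' ] x ≡ suc x' × P x y) (sumF (n ∘ suc))
  CS = card-map (×-isEquivalence ≡-eq e) (λ (x , y) → suc x , y) (λ { (refl , q) → refl , q })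
         (λ {a} p → _ , refl , p) (λ { _ _ (refl , q) → refl , q })
         (λ { (_ , y) (x , refl , p) → (x , y) , p , (refl , E.refl) })
         (card-Σ b e (P ∘ suc) (n ∘ suc) (C ∘ suc))

card-Π : ∀ h {Y : Set} {_≈_ : Y → Y → Set} → IsEquivalence _≈_ → (P : Fin h → Y → Set) (n : Fin h → ℕ) →
  (∀ t → Card _≈_ (P t) (n t)) → Card (Pointwise _≈_) (λ φ → ∀ t → P t (φ t)) (prodF n)
card-Π zero    e P n C = card-one (λ ()) (λ ()) (λ _ _ ())
card-Π (suc h) e P n C = card-map (Pointwise.isEquivalence e _) (λ (y , φ) → y VF.∷ φ)
  (λ { (p , q) zero → p ; (p , q) (suc t) → q t })
  (λ { (p , q) zero → p ; (p , q) (suc t) → q t })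
  (λ _ _ r → r zero , r ∘ suc)
  (λ φ p → (φ zero , φ ∘ suc) , (p zero , p ∘ suc) , λ { zero → E.refl ; (suc t) → E.refl })
  (card-× (C zero) (card-Π h e (P ∘ suc) (n ∘ suc) (C ∘ suc)))
  where module E = IsEquivalence e

countDec : ∀ {n} {P : Fin n → Set} → (∀ x → Dec (P x)) → ℕ
countDec P? = sumF (λ x → if does (P? x) then 1 else 0)

-- Over each `x` stands a fibre with one element or none, so the sum of the fibre sizes counts the
-- `x` in `P`.
card-dec : ∀ {n} {P : Fin n → Set} (P? : ∀ x → Dec (P x)) → Card _≡_ P (countDec P?)
card-dec {n} {P} P? = card-map ≡-eq proj₁ proj₁ id (λ _ _ p → p , refl) (λ x p → (x , tt) , p , refl)
  (card-Σ n {⊤} ≡-eq (λ x _ → P x) _ (λ x → one x (P? x)))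
  where
  one : ∀ x (d : Dec (P x)) → Card _≡_ (λ _ → P x) (if does d then 1 else 0)
  one x (yes p) = card-one tt p (λ _ _ → refl)
  one x (no np) = card-empty (λ _ → np)

sum-allFin : ∀ {b} (n : Fin b → ℕ) → sum (map n (allFin b)) ≡ sumF n
sum-allFin {b} n = trans (cong sum (map-tabulate id n)) (go n)
  where
  go : ∀ {b} (n : Fin b → ℕ) → sum (tabulate n) ≡ sumF n
  go {zero}  n = refl
  go {suc b} n = cong (n zero +_) (go (n ∘ suc))

sum-concatMap : ∀ {A B : Set} (n : B → ℕ) (f : A → List B) (xs : List A) →
  sum (map n (concatMap f xs)) ≡ sum (map (λ x → sum (map n (f x))) xs)
sum-concatMap n f []       = refl
sum-concatMap n f (x ∷ xs) = trans (cong sum (map-++ n (f x) (concatMap f xs)))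
  (trans (sum-++ (map n (f x)) _) (cong (sum (map n (f x)) +_) (sum-concatMap n f xs)))

sum-allFuns : ∀ a b (n : (Fin (suc a) → Fin b) → ℕ) →
  sum (map n (allFuns (suc a) b)) ≡ sumF (λ x → sum (map (λ f → n (x VF.∷ f)) (allFuns a b)))
sum-allFuns a b n = trans (sum-concatMap n (λ x → map (x VF.∷_) (allFuns a b)) (allFin b))
  (trans (cong sum (map-cong (λ x → cong sum (sym (map-∘ (allFuns a b)))) (allFin b))) (sum-allFin {b} _))

-- A fibrewise count over a base of functions. The total is a sum over `allFuns`, the list used both
-- by `hom` and by the polynomial; `resp` makes the fibres depend only on the values of `s`.
card-allFuns : ∀ a b {Y : Set} {_≈_ : Y → Y → Set} → IsEquivalence _≈_ →
  (P : (Fin a → Fin b) → Y → Set) → (∀ {s s' y} → s ≋ s' → P s y → P s' y) →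
  (n : (Fin a → Fin b) → ℕ) → (∀ s → Card _≈_ (P s) (n s)) →
  Card (_≋_ ×ᴿ _≈_) (λ (s , y) → P s y) (sum (map n (allFuns a b)))
card-allFuns zero b {Y} {_≈_} e P resp n C = base _
  where
  -- A variable `s₀` stands for the empty function listed by `allFuns`, which agrees with any other
  -- only pointwise.
  base : ∀ s₀ → Card (_≋_ ×ᴿ _≈_) (λ (s , y) → P s y) (n s₀ + 0)
  base s₀ = subst (Card _ _) (sym (+-identityʳ (n s₀)))
    (card-map (×-isEquivalence ≋-eq e) (s₀ ,_) ((λ ()) ,_) id (λ _ _ → proj₂)
      (λ (s , y) p → y , resp (λ ()) p , ((λ ()) , IsEquivalence.refl e)) (C s₀))
card-allFuns (suc a) b {Y} {_≈_} e P resp n C = subst (Card _ _) (sym (sum-allFuns a b n))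
  (card-map (×-isEquivalence ≋-eq e) (λ (x , s , y) → (x VF.∷ s) , y)
    (λ { (refl , q , r) → (λ { zero → refl ; (suc i) → q i }) , r })
    id
    (λ _ _ (q , r) → q zero , q ∘ suc , r)
    (λ (s , y) p → (s zero , s ∘ suc , y) , resp (λ { zero → refl ; (suc i) → refl }) p
                 , ((λ { zero → refl ; (suc i) → refl }) , IsEquivalence.refl e))
    (card-Σ b (×-isEquivalence ≋-eq e) (λ x (s , y) → P (x VF.∷ s) y) _
      (λ x → card-allFuns a b e (λ s → P (x VF.∷ s)) (λ q → resp (λ { zero → refl ; (suc i) → q i })) _ (λ s → C (x VF.∷ s)))))

does⁻ : ∀ {A : Set} (d : Dec A) → does d ≡ true → A
does⁻ (yes a) _ = a

-- Rooted trees

iter-+ : ∀ {A : Set} (f : A → A) i j x → iter f (i + j) x ≡ iter f j (iter f i x)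
iter-+ f zero    j x = refl
iter-+ f (suc i) j x = iter-+ f i j (f x)

iter-commute : ∀ {A B : Set} {f : A → A} {g : B → B} (c : A → B) → (∀ x → c (f x) ≡ g (c x)) →
  ∀ j x → c (iter f j x) ≡ iter g j (c x)
iter-commute         c e zero    x = refl
iter-commute {g = g} c e (suc j) x = trans (iter-commute c e j _) (cong (iter g j) (e x))

iter-fix : ∀ {A : Set} (f : A → A) {x} → f x ≡ x → ∀ j → iter f j x ≡ x
iter-fix f p zero    = refl
iter-fix f p (suc j) = trans (cong (iter f j) p) (iter-fix f p j)

iter-∸ : ∀ {A : Set} (f : A → A) {i j} → i ≤ j → ∀ x → iter f (j ∸ i) (iter f i x) ≡ iter f j x
iter-∸ f {i} {j} i≤j x = trans (sym (iter-+ f i (j ∸ i) x)) (cong (λ z → iter f z x) (m+[n∸m]≡n i≤j))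

iter-fixed-≤ : ∀ {A : Set} (f : A → A) {i j x r} → f r ≡ r → i ≤ j → iter f i x ≡ r → iter f j x ≡ r
iter-fixed-≤ f {i} {j} {x} fr i≤j p =
  trans (sym (iter-∸ f i≤j x)) (trans (cong (iter f (j ∸ i)) p) (iter-fix f fr (j ∸ i)))

module _ {h} (T : RootedTree h) where

  InPath-trans : ∀ {u t s} → InPath T u t → InPath T t s → InPath T u s
  InPath-trans {u} {t} {s} (i , p) (j , q) = j + i , trans (iter-+ (parent T) j i s) (trans (cong (iter (parent T) i) q) p)

  -- The first `h + 1` iterates suffice: after `h` steps the path has reached the root and stays
  -- there.
  inPath? : ∀ t s → Dec (InPath T t s)
  inPath? t s = map′ (λ (j , p) → toℕ j , p) bound (any? {suc h} (λ j → iter (parent T) (toℕ j) s ≟ t))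
    where
    bound : InPath T t s → ∃[ j ] iter (parent T) (toℕ {suc h} j) s ≡ t
    bound (j , p) with j ℕ.≤? h
    ... | yes j≤h = fromℕ< (s≤s j≤h) , trans (cong (λ z → iter (parent T) z s) (toℕ-fromℕ< (s≤s j≤h))) p
    ... | no j≰h = fromℕ< (≤-refl {suc h}) , trans (cong (λ z → iter (parent T) z s) (toℕ-fromℕ< (≤-refl {suc h})))
            (trans (reaches T s) (trans (sym (iter-fixed-≤ (parent T) (parent-root T) (<⇒≤ (≰⇒> j≰h)) (reaches T s))) p))

-- Equations between variables and the constant 0

ev : ∀ {c} → (Fin c → ℕ) → Maybe (Fin c) → ℕ
ev ψ = maybe′ ψ 0

ev->>= : ∀ {a c} (ψ : Fin c → ℕ) (ρ : Fin a → Maybe (Fin c)) u → ev ψ (u >>= ρ) ≡ ev (λ x → ev ψ (ρ x)) u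
ev->>= ψ ρ (just x) = refl
ev->>= ψ ρ nothing  = refl

ev-cong : ∀ {c} {ψ ψ' : Fin c → ℕ} → ψ ≋ ψ' → ∀ u → ev ψ u ≡ ev ψ' u
ev-cong p (just x) = p x
ev-cong p nothing  = refl

Eqn : ℕ → Set
Eqn a = Maybe (Fin a) × Maybe (Fin a)

Sat : ∀ {a} → (Fin a → ℕ) → Eqn a → Set
Sat φ (u , v) = ev φ u ≡ ev φ v

-- The solutions are the assignments x ↦ ψ (ρ x) with ψ arbitrary on c free variables; r picks a
-- variable of the system equal to a given free one.
record Param {a} (Sol : (Fin a → ℕ) → Set) : Set where
  field
    c        : ℕ
    ρ        : Fin a → Maybe (Fin c)
    r        : Fin c → Fin a
    ρ∘r      : ∀ j → ρ (r j) ≡ just j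
    sound    : ∀ ψ → Sol (λ x → ev ψ (ρ x))
    complete : ∀ φ → Sol φ → ∀ x → φ x ≡ ev (φ ∘ r) (ρ x)

-- Elimination of the free variable j by means of the equation j = w.
module Eliminate {c} (j : Fin (suc c)) (w : Maybe (Fin (suc c))) (w≢j : w ≢ just j) where

  -- The term `w` in the numbering without `j`.
  lower : (w : Maybe (Fin (suc c))) → w ≢ just j → Maybe (Fin c)
  lower nothing  _ = nothing
  lower (just i) q = just (punchOut {i = j} {j = i} (λ p → q (cong just (sym p))))

  σ : Fin (suc c) → Maybe (Fin c)
  σ i with j ≟ i
  ... | yes _  = lower w w≢j
  ... | no j≢i = just (punchOut j≢i)

  σ-punchIn : ∀ i → σ (punchIn j i) ≡ just i
  σ-punchIn i with j ≟ punchIn j i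
  ... | yes p = ⊥-elim (punchInᵢ≢i j i (sym p))
  ... | no q  = cong just (trans (punchOut-cong j refl) (punchOut-punchIn j))

  σ-j : σ j ≡ lower w w≢j
  σ-j with j ≟ j
  ... | yes _ = refl
  ... | no q  = ⊥-elim (q refl)

  ev-lower : ∀ (φ : Fin (suc c) → ℕ) w q → ev (φ ∘ punchIn j) (lower w q) ≡ ev φ w
  ev-lower φ nothing  q = refl
  ev-lower φ (just i) q = cong φ (punchIn-punchOut _)

  -- Soundness of the elimination: whatever the remaining variables are, the substitution `σ`
  -- respects `j = w`.
  ev-σ : ∀ ψ → ev ψ (σ j) ≡ ev (λ i → ev ψ (σ i)) w
  ev-σ ψ = trans (cong (ev ψ) σ-j) (trans (ev-cong (λ i → cong (ev ψ) (sym (σ-punchIn i))) (lower w w≢j))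
             (ev-lower (λ i → ev ψ (σ i)) w w≢j))

  -- Completeness of the elimination: `w` does not involve `j`, so the values off `j` determine the
  -- one at `j`.
  ev-σ-punchIn : ∀ φ → φ j ≡ ev φ w → ∀ i → φ i ≡ ev (φ ∘ punchIn j) (σ i)
  ev-σ-punchIn φ p i with j ≟ i
  ... | yes refl = trans p (sym (ev-lower φ w w≢j))
  ... | no q     = cong φ (sym (punchIn-punchOut q))

Sat-cong : ∀ {a} {φ φ' : Fin a → ℕ} → φ ≋ φ' → ∀ {e} → Sat φ e → Sat φ' e
Sat-cong p {u , v} q = trans (sym (ev-cong p u)) (trans q (ev-cong p v))

-- Each equation is rewritten in the free variables of the system solved so far. It is then either
-- trivial or removes one free variable.
solve : ∀ {a} (E : List (Eqn a)) → Param (λ φ → All (Sat φ) E)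
solve {a} [] = record { c = a ; ρ = just ; r = id ; ρ∘r = λ _ → refl ; sound = λ _ → [] ; complete = λ _ _ _ → refl }
solve {a} ((u , v) ∷ E) with solve E
... | P = go (u >>= ρ) (v >>= ρ) refl refl
  where
  open Param P
  NewSol : (Fin a → ℕ) → Set
  NewSol φ = All (Sat φ) ((u , v) ∷ E)

  -- The last two hypotheses say that, for solutions of `E`, the new equation amounts to `j = w`.
  elim : ∀ {c'} (ec : c ≡ suc c') (j : Fin c) (w : Maybe (Fin c)) → w ≢ just j →
    (∀ ψ → ψ j ≡ ev ψ w → Sat (λ x → ev ψ (ρ x)) (u , v)) →
    (∀ φ → NewSol φ → φ (r j) ≡ ev (φ ∘ r) w) →
    Param NewSol
  elim {c'} refl j w w≢j to from = record
    { c = c'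
    ; ρ = λ x → ρ x >>= σ
    ; r = r ∘ punchIn j
    ; ρ∘r = λ i → trans (cong (_>>= σ) (ρ∘r (punchIn j i))) (σ-punchIn i)
    ; sound = λ ψ →
        let eq = λ x → sym (ev->>= ψ σ (ρ x)) in
        Sat-cong eq {u , v} (to (λ i → ev ψ (σ i)) (ev-σ ψ)) ∷ All.map (λ {e} → Sat-cong eq {e}) (sound _)
    ; complete = λ { φ s@(_ ∷ s') x → trans (complete φ s' x)
        (trans (ev-cong (ev-σ-punchIn (φ ∘ r) (from φ s)) (ρ x)) (sym (ev->>= _ σ (ρ x)))) } }
    where open Eliminate j w w≢j

  sat-ρ : ∀ φ → NewSol φ → ∀ w → ev φ w ≡ ev (φ ∘ r) (w >>= ρ)
  sat-ρ φ (_ ∷ s) w = trans (ev-cong (complete φ s) w) (sym (ev->>= (φ ∘ r) ρ w))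

  sucOf : ∀ {c} → Fin c → ∃[ c' ] c ≡ suc c'
  sucOf {suc c'} _ = c' , refl

  go : ∀ u' v' → (u >>= ρ) ≡ u' → (v >>= ρ) ≡ v' → Param NewSol
  go u' v' pu pv with Maybe.≡-dec _≟_ u' v'
  go u' v' pu pv | yes u'≡v' = record
    { c = c ; ρ = ρ ; r = r ; ρ∘r = ρ∘r
    ; sound = λ ψ → trans (sym (ev->>= ψ ρ u)) (trans (cong (ev ψ) (trans pu (trans u'≡v' (sym pv)))) (ev->>= ψ ρ v)) ∷ sound ψ
    ; complete = λ { φ (_ ∷ s) → complete φ s } }
  go (just j) v' pu pv | no ne = elim (proj₂ (sucOf j)) j v' (λ p → ne (sym p))
    (λ ψ p → trans (sym (ev->>= ψ ρ u)) (trans (cong (ev ψ) pu) (trans p (trans (cong (ev ψ) (sym pv)) (ev->>= ψ ρ v)))))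
    (λ { φ s@(e ∷ _) → trans (cong (ev (φ ∘ r)) (sym pu)) (trans (sym (sat-ρ φ s u)) (trans e (trans (sat-ρ φ s v) (cong (ev (φ ∘ r)) pv)))) })
  -- The left side has become 0, so the free variable on the right is set to 0.
  go nothing (just j) pu pv | no ne = elim (proj₂ (sucOf j)) j nothing (λ ())
    (λ ψ p → trans (sym (ev->>= ψ ρ u)) (trans (cong (ev ψ) pu) (trans (sym p) (trans (cong (ev ψ) (sym pv)) (ev->>= ψ ρ v)))))
    (λ { φ s@(e ∷ _) → trans (cong (ev (φ ∘ r)) (sym pv)) (trans (sym (sat-ρ φ s v)) (trans (sym e) (trans (sat-ρ φ s u) (cong (ev (φ ∘ r)) pu)))) })
  go nothing nothing pu pv | no ne = ⊥-elim (ne refl)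

-- Labellings constant along edges

module Labelings {a} (D : Fin a → Set) (D? : ∀ x → Dec (D x)) (e : Fin a → Fin a → Bool) where

  Labeling : ℕ → (Fin a → ℕ) → Set
  Labeling k φ = (∀ x → (D x → 1 ≤ φ x × φ x ≤ k) × (¬ D x → φ x ≡ 0)) ×
                 (∀ x y → e x y ≡ true → D x → D y → φ x ≡ φ y)

  Linked : Fin a → Fin a → Set
  Linked x y = e x y ≡ true × D x × D y

  linked? : ∀ x y → Dec (Linked x y)
  linked? x y = (e x y Bool.≟ true) ×-dec (D? x ×-dec D? y)

  -- An equation that does not apply is replaced by `0 = 0`, so the system can be listed over all
  -- vertices and all pairs.
  when : ∀ {A : Set} → Dec A → Eqn a → Eqn a
  when (yes _) e = e
  when (no _)  _ = nothing , nothing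

  when⁺ : ∀ {A : Set} {φ e} (d : Dec A) → (A → Sat φ e) → Sat φ (when d e)
  when⁺ (yes p) f = f p
  when⁺ (no _)  f = refl

  when⁻ : ∀ {A : Set} {φ e} (d : Dec A) → Sat φ (when d e) → A → Sat φ e
  when⁻ (yes _) s _ = s
  when⁻ (no q)  _ p = ⊥-elim (q p)

  zeroEqn : Fin a → Eqn a
  zeroEqn x = when (¬? (D? x)) (just x , nothing)

  edgeEqn : Fin a → Fin a → Eqn a
  edgeEqn x y = when (linked? x y) (just x , just y)

  eqns : List (Eqn a)
  eqns = map zeroEqn (allFin a) ++ concatMap (λ x → map (edgeEqn x) (allFin a)) (allFin a)

  -- The part of `Labeling` expressible by equations; the bounds are imposed later on the free
  -- variables.
  Sol : (Fin a → ℕ) → Set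
  Sol φ = (∀ x → ¬ D x → φ x ≡ 0) × (∀ x y → Linked x y → φ x ≡ φ y)

  eqns⁺ : ∀ {φ} → Sol φ → All (Sat φ) eqns
  eqns⁺ {φ} (z , l) = All.++⁺
    (All.map⁺ (All.tabulate⁺ λ x → when⁺ {e = just x , nothing} (¬? (D? x)) (z x)))
    (All.concat⁺ (All.map⁺ (All.tabulate⁺ λ x → All.map⁺ (All.tabulate⁺ λ y →
      when⁺ {e = just x , just y} (linked? x y) (l x y)))))

  eqns⁻ : ∀ {φ} → All (Sat φ) eqns → Sol φ
  eqns⁻ {φ} s =
    (λ x → when⁻ {e = just x , nothing} (¬? (D? x)) (All.tabulate⁻ (All.map⁻ (All.++⁻ˡ (map zeroEqn (allFin a)) s)) x)) ,
    (λ x y → when⁻ {e = just x , just y} (linked? x y)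
      (All.tabulate⁻ (All.map⁻ (All.tabulate⁻ (All.map⁻ (All.concat⁻ (All.++⁻ʳ (map zeroEqn (allFin a)) s))) x)) y))

  -- The number `c` of variables left free is the number of connected components of `D`: one value
  -- per component, and 0 outside `D`.
  open Param (solve eqns) using (c; ρ; r; ρ∘r; sound; complete) public

  -- The indicator function of D is a solution, so no variable in D is forced to be 0.
  D-ρ : ∀ x → D x → ∃[ j ] ρ x ≡ just j
  D-ρ x dx with ρ x in eq
  ... | just j = j , refl
  ... | nothing = contradiction (trans (sym (ind-D x dx)) (trans (complete ind (eqns⁺ ind-sol) x) (cong (ev (ind ∘ r)) eq))) λ ()
    where
    ind : Fin a → ℕ
    ind x = if does (D? x) then 1 else 0
    ind-D : ∀ x → D x → ind x ≡ 1
    ind-D x d with D? x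
    ... | yes _ = refl
    ... | no q = ⊥-elim (q d)
    ind-¬D : ∀ x → ¬ D x → ind x ≡ 0
    ind-¬D x d with D? x
    ... | yes q = ⊥-elim (d q)
    ... | no _ = refl
    ind-sol : Sol ind
    ind-sol = ind-¬D , λ x y (_ , dx , dy) → trans (ind-D x dx) (sym (ind-D y dy))

  -- Setting every free variable to 1 gives a solution. It vanishes outside `D` but takes the value
  -- 1 at `r j`.
  D-r : ∀ j → D (r j)
  D-r j with D? (r j)
  ... | yes p = p
  ... | no q  = contradiction (trans (sym (proj₁ (eqns⁻ (sound (λ _ → 1))) (r j) q)) (cong (ev (λ _ → 1)) (ρ∘r j))) λ ()

  -- Labellings correspond to free choices from 1 to `k` for the `c` variables. By `D-ρ` the bounds
  -- pass from the variables to `D`, and by `D-r` back again.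
  card-labelings : ∀ k → Card _≋_ (Labeling k) (k ^ c)
  card-labelings k = subst (Card _≋_ (Labeling k)) (prodF-const c k)
    (card-map ≋-eq (λ ψ x → ev ψ (ρ x)) (λ p x → ev-cong p (ρ x)) lab inj surj
      (card-Π c ≡-eq (λ _ v → 1 ≤ v × v ≤ k) (λ _ → k) (λ _ → card-interval k)))
    where
    lab : ∀ {ψ} → (∀ j → 1 ≤ ψ j × ψ j ≤ k) → Labeling k (λ x → ev ψ (ρ x))
    lab {ψ} b = (λ x → (λ dx → let (j , p) = D-ρ x dx in subst (λ u → 1 ≤ ev ψ u × ev ψ u ≤ k) (sym p) (b j))
                     , proj₁ s x)
             , (λ x y exy dx dy → proj₂ s x y (exy , dx , dy))
      where s = eqns⁻ (sound ψ)
    inj : ∀ {ψ ψ'} → (∀ j → 1 ≤ ψ j × ψ j ≤ k) → (∀ j → 1 ≤ ψ' j × ψ' j ≤ k) → (λ x → ev ψ (ρ x)) ≋ (λ x → ev ψ' (ρ x)) → ψ ≋ ψ'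
    inj {ψ} {ψ'} _ _ p j = trans (cong (ev ψ) (sym (ρ∘r j))) (trans (p (r j)) (cong (ev ψ') (ρ∘r j)))
    surj : ∀ φ → Labeling k φ → ∃[ ψ ] (∀ j → 1 ≤ ψ j × ψ j ≤ k) × ((λ x → ev ψ (ρ x)) ≋ φ)
    surj φ (b , l) = φ ∘ r , (λ j → proj₁ (b (r j)) (D-r j))
      , λ x → sym (complete φ (eqns⁺ ((λ x → proj₂ (b x)) , λ x y (exy , dx , dy) → l x y exy dx dy)) x)

-- Homomorphism counts of branchings

Hom : ∀ {a b} → SGraph a → SGraph b → (Fin a → Fin b) → Set
Hom X Y f = ∀ i j → adj X i j ≡ true → adj Y (f i) (f j) ≡ true

hom? : ∀ {a b} (X : SGraph a) (Y : SGraph b) f → Dec (Hom X Y f)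
hom? X Y f = all? λ i → all? λ j → (adj X i j Bool.≟ true) →-dec (adj Y (f i) (f j) Bool.≟ true)

andL⁺ : ∀ {xs} → All (_≡ true) xs → andL xs ≡ true
andL⁺ []         = refl
andL⁺ (refl ∷ p) = andL⁺ p

andL⁻ : ∀ xs → andL xs ≡ true → All (_≡ true) xs
andL⁻ []          _ = []
andL⁻ (true ∷ xs) p = refl ∷ andL⁻ xs p

isHom⁺ : ∀ {a b} (X : SGraph a) (Y : SGraph b) {f} → Hom X Y f → isHom X Y f ≡ true
isHom⁺ X Y {f} p = andL⁺ (All.concat⁺ (All.map⁺ (All.tabulate⁺ λ i → All.map⁺ (All.tabulate⁺ (imp i)))))
  where
  imp : ∀ i j → not (adj X i j) ∨ adj Y (f i) (f j) ≡ true
  imp i j with adj X i j in eq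
  ... | true = p i j eq
  ... | false = refl

isHom⁻ : ∀ {a b} (X : SGraph a) (Y : SGraph b) {f} → isHom X Y f ≡ true → Hom X Y f
isHom⁻ X Y {f} p i j = imp (All.tabulate⁻ (All.map⁻ (All.tabulate⁻ (All.map⁻ (All.concat⁻ (andL⁻ _ p))) i)) j)
  where
  imp : not (adj X i j) ∨ adj Y (f i) (f j) ≡ true → adj X i j ≡ true → adj Y (f i) (f j) ≡ true
  imp q r rewrite r = q

length-filter : ∀ {A : Set} (b : A → Bool) (xs : List A) →
  length (filter (λ x → b x Bool.≟ true) xs) ≡ sum (map (λ x → if b x then 1 else 0) xs)
length-filter b []       = refl
length-filter b (x ∷ xs) with b x
... | true  = cong suc (length-filter b xs)
... | false = length-filter b xs

-- The filtered list is a sum of indicators, and each indicator is the size of a fibre with one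
-- element or none.
card-hom : ∀ {a b} (X : SGraph a) (Y : SGraph b) → Card _≋_ (Hom X Y) (hom (a , X) (b , Y))
card-hom {a} {b} X Y = subst (Card _≋_ (Hom X Y)) (sym (length-filter (isHom X Y) (allFuns a b)))
  (card-map ≋-eq proj₁ proj₁ id (λ _ _ p → p , refl) (λ f p → (f , tt) , p , λ _ → refl)
    (card-allFuns a b {⊤} ≡-eq (λ f _ → Hom X Y f)
      (λ q p i j e → subst₂ (λ u v → adj Y u v ≡ true) (q i) (q j) (p i j e)) _ one))
  where
  one : ∀ f → Card _≡_ (λ _ → Hom X Y f) (if isHom X Y f then 1 else 0)
  one f with isHom X Y f in eq
  ... | true = card-one tt (isHom⁻ X Y eq) (λ _ _ → refl)
  ... | false = card-empty (λ _ p → contradiction (trans (sym eq) (isHom⁺ X Y p)) λ ())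

-- Counts as rational numbers and values of polynomials

toℚᵘ-toℚ : ∀ n → toℚᵘ (toℚ n) ≃ᵘ mkℚᵘ (ℤ.+ n) 0
toℚᵘ-toℚ n = ℚ.toℚᵘ-fromℚᵘ (mkℚᵘ (ℤ.+ n) 0)

toℚ-+ : ∀ m n → toℚ (m + n) ≡ toℚ m +ℚ toℚ n
toℚ-+ m n = ℚ.toℚᵘ-injective (ℚᵘ.≃-trans (toℚᵘ-toℚ (m + n)) (ℚᵘ.≃-sym
  (ℚᵘ.≃-trans (ℚ.toℚᵘ-homo-+ (toℚ m) (toℚ n)) (ℚᵘ.≃-trans (ℚᵘ.+-cong (toℚᵘ-toℚ m) (toℚᵘ-toℚ n))
    (*≡* (cong (ℤ._* ℤ.+ 1) (cong₂ ℤ._+_ (ℤ.*-identityʳ (ℤ.+ m)) (ℤ.*-identityʳ (ℤ.+ n)))))))))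

toℚ-* : ∀ m n → toℚ (m * n) ≡ toℚ m *ℚ toℚ n
toℚ-* m n = ℚ.toℚᵘ-injective (ℚᵘ.≃-trans (toℚᵘ-toℚ (m * n)) (ℚᵘ.≃-sym
  (ℚᵘ.≃-trans (ℚ.toℚᵘ-homo-* (toℚ m) (toℚ n)) (ℚᵘ.≃-trans (ℚᵘ.*-cong (toℚᵘ-toℚ m) (toℚᵘ-toℚ n))
    (*≡* (cong (ℤ._* ℤ.+ 1) (sym (ℤ.pos-* m n))))))))

toℚ-prodF : ∀ {h} (n : Fin h → ℕ) → toℚ (prodF n) ≡ prodFin (λ i → toℚ (n i))
toℚ-prodF {zero}  n = refl
toℚ-prodF {suc h} n = trans (toℚ-* (n zero) (prodF (n ∘ suc))) (cong (toℚ (n zero) *ℚ_) (toℚ-prodF (n ∘ suc)))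

-- One monomial per list element, with coefficient 0 for the elements that do not count.
evalPoly-map : ∀ {A : Set} {h} (b : A → Bool) (e : A → Vecℕ h) k (xs : List A) →
  evalPoly (map (λ x → (if b x then 1ℚ else 0ℚ) , e x) xs) k
  ≡ toℚ (sum (map (λ x → if b x then prodF (λ i → k i ^ e x i) else 0) xs))
evalPoly-map b e k []       = refl
evalPoly-map b e k (x ∷ xs) = trans (cong₂ _+ℚ_ (term (b x)) (evalPoly-map b e k xs))
  (sym (toℚ-+ (if b x then prodF (λ i → k i ^ e x i) else 0) _))
  where
  term : ∀ z → (if z then 1ℚ else 0ℚ) *ℚ prodFin (λ i → toℚ (k i ^ e x i))
             ≡ toℚ (if z then prodF (λ i → k i ^ e x i) else 0)
  term true  = trans (ℚ.*-identityˡ _) (sym (toℚ-prodF (λ i → k i ^ e x i)))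
  term false = ℚ.*-zeroˡ (prodFin (λ i → toℚ (k i ^ e x i)))

-- The branching as a graph and its homomorphism counts

module Branching {h} (T : RootedTree h) (G : SGraph h) (sub : SubClos T G) where

  BV : Set
  BV = Fin h × Vecℕ h

  _≈ᵇ_ : BV → BV → Set
  _≈ᵇ_ = _≡_ ×ᴿ _≋_

  ≈ᵇ-eq : IsEquivalence _≈ᵇ_
  ≈ᵇ-eq = ×-isEquivalence ≡-eq ≋-eq

  -- The conditions of `BVertex` grouped by coordinate, so that `card-Π` counts the labels one
  -- coordinate at a time.
  Valid : Vecℕ h → BV → Set
  Valid k (s , φ) = ∀ t → (InPath T t s → 1 ≤ φ t × φ t ≤ k t) × (¬ InPath T t s → φ t ≡ 0)

  -- Since G ⊆ clos(T), adjacent s and s' satisfy P(s) ∩ P(s') = P(the upper one).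
  Adjacent : BV → BV → Set
  Adjacent (s , φ) (s' , φ') = adj G s s' ≡ true × (∀ u → InPath T u s → InPath T u s' → φ u ≡ φ' u)

  adjacent? : ∀ v w → Dec (Adjacent v w)
  adjacent? (s , φ) (s' , φ') = (adj G s s' Bool.≟ true) ×-dec
    all? (λ u → inPath? T u s →-dec (inPath? T u s' →-dec (φ u ℕ.≟ φ' u)))

  Adjacent-sym : ∀ {v w} → Adjacent v w → Adjacent w v
  Adjacent-sym {s , _} {s' , _} (p , q) = trans (adj-sym G s' s) p , λ u x y → sym (q u y x)

  Adjacent-irrefl : ∀ v → ¬ Adjacent v v
  Adjacent-irrefl (s , _) (p , _) = contradiction (trans (sym p) (irrefl G s)) λ ()

  Adjacent-resp : ∀ {v v' w w'} → v ≈ᵇ v' → w ≈ᵇ w' → Adjacent v w → Adjacent v' w'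
  Adjacent-resp (refl , p) (refl , q) (a , r) = a , λ u x y → trans (sym (p u)) (trans (r u x y) (q u))

  module _ (k : Vecℕ h) where

    toBV : BVertex T k → BV
    toBV (s , φ , _) = s , φ

    toBVertex : ∀ v → Valid k v → BVertex T k
    toBVertex (s , φ) p = s , φ , (λ t → proj₁ (p t)) , (λ t → proj₂ (p t))

    toBV-valid : ∀ v → Valid k (toBV v)
    toBV-valid (s , φ , p , q) t = p t , q t

    BAdj⇒Adjacent : ∀ {v w} → BAdj T G k v w → Adjacent (toBV v) (toBV w)
    BAdj⇒Adjacent (inj₁ (_ , a , p)) = a , λ u _ x → sym (p u x)
    BAdj⇒Adjacent {s , _} {t , _} (inj₂ (_ , a , p)) = trans (adj-sym G s t) a , λ u x _ → p u x

    Adjacent⇒BAdj : ∀ {v w} → Adjacent (toBV v) (toBV w) → BAdj T G k v w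
    Adjacent⇒BAdj {s , _} {t , _} (a , p) with sub s t a
    ... | inj₁ anc = inj₂ (anc , trans (adj-sym G t s) a , λ u x → p u x (InPath-trans T x (proj₁ anc)))
    ... | inj₂ anc = inj₁ (anc , a , λ u x → sym (p u (InPath-trans T x (proj₁ anc)) x))

    -- Off the path the only admissible label is 0, hence the factor 1.
    width : Fin h → Fin h → ℕ
    width s t = if does (inPath? T t s) then k t else 1

    size : ℕ
    size = sumF (λ s → prodF (width s))

    card-vertices : Card _≈ᵇ_ (Valid k) size
    card-vertices = card-Σ h ≋-eq (λ s φ → Valid k (s , φ)) _
      λ s → card-Π h ≡-eq (λ t v → (InPath T t s → 1 ≤ v × v ≤ k t) × (¬ InPath T t s → v ≡ 0)) (width s) (λ t → label s t (inPath? T t s))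
      where
      label : ∀ s t (d : Dec (InPath T t s)) →
        Card _≡_ (λ v → (InPath T t s → 1 ≤ v × v ≤ k t) × (¬ InPath T t s → v ≡ 0)) (if does d then k t else 1)
      label s t (yes p) = card-map ≡-eq id id (λ q → (λ _ → q) , (λ np → ⊥-elim (np p))) (λ _ _ q → q)
                      (λ v (q , _) → v , q p , refl) (card-interval (k t))
      label s t (no np) = card-one 0 ((λ p → ⊥-elim (np p)) , λ _ → refl) (λ v (_ , q) → sym (q np))

    vertex : Fin size → BV
    vertex = at card-vertices

    branching : SGraph size
    branching = record
      { adj = λ i j → does (adjacent? (vertex i) (vertex j))
      ; sym = λ i j → does-⇔ (mk⇔ Adjacent-sym Adjacent-sym) (adjacent? (vertex i) (vertex j)) (adjacent? (vertex j) (vertex i))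
      ; irrefl = λ i → dec-false (adjacent? (vertex i) (vertex i)) (Adjacent-irrefl (vertex i)) }

    isoBranch : IsoBranch (size , branching) T G k
    isoBranch = f , g , (λ i → at-inj card-vertices _ _ (proj₂ (g′ (f i))))
      , (λ v → proj₂ (g′ v))
      , (λ v w v≈w → at-inj card-vertices _ _ (E.trans (proj₂ (g′ v)) (E.trans v≈w (E.sym (proj₂ (g′ w))))))
      , (λ x y → (λ p → Adjacent⇒BAdj {f x} {f y} (does⁻ (adjacent? _ _) p))
               , (λ p → dec-true (adjacent? _ _) (BAdj⇒Adjacent {f x} {f y} p)))
      where
      module E = IsEquivalence ≈ᵇ-eq
      f : Fin size → BVertex T k
      f i = toBVertex (vertex i) (at-P card-vertices i)
      g′ : ∀ v → ∃[ i ] vertex i ≈ᵇ toBV v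
      g′ v = at-surj card-vertices (toBV v) (toBV-valid v)
      g : BVertex T k → Fin size
      g v = proj₁ (g′ v)

  module _ {a} (X : SGraph a) where

    module L (s : Fin a → Fin h) (t : Fin h) =
      Labelings (λ x → InPath T t (s x)) (λ x → inPath? T t (s x)) (adj X)

    -- A map to the branching, split into its projection `s` to `G` and, for each `t`, the labels
    -- `φ t` at `t`. Transposing the labels makes the conditions for different `t` independent.
    Lifted : Vecℕ h → (Fin a → Fin h) × (Fin h → Fin a → ℕ) → Set
    Lifted k (s , φ) = Hom X G s × (∀ t → L.Labeling s t (k t) (φ t))

    liftedCount : Vecℕ h → (Fin a → Fin h) → ℕ
    liftedCount k s = if does (hom? X G s) then prodF (λ t → k t ^ L.c s t) else 0

    card-lifted : ∀ k → Card (_≋_ ×ᴿ Pointwise _≋_) (Lifted k) (sum (map (liftedCount k) (allFuns a h)))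
    card-lifted k = card-allFuns a h (Pointwise.isEquivalence ≋-eq _) (λ s φ → Lifted k (s , φ)) resp (liftedCount k) (λ s → fibre s (hom? X G s))
      where
      resp : ∀ {s s' φ} → s ≋ s' → Lifted k (s , φ) → Lifted k (s' , φ)
      resp {s} {s'} p (q , l) =
        (λ i j e → subst₂ (λ u v → adj G u v ≡ true) (p i) (p j) (q i j e)) ,
        λ t → (λ x → (λ d → proj₁ (proj₁ (l t) x) (subst (InPath T t) (sym (p x)) d))
                   , (λ d → proj₂ (proj₁ (l t) x) (λ d' → d (subst (InPath T t) (p x) d'))))
            , λ x y e dx dy → proj₂ (l t) x y e (subst (InPath T t) (sym (p x)) dx) (subst (InPath T t) (sym (p y)) dy)
      fibre : ∀ s (d : Dec (Hom X G s)) →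
        Card (Pointwise _≋_) (λ φ → Lifted k (s , φ)) (if does d then prodF (λ t → k t ^ L.c s t) else 0)
      fibre s (no q)  = card-empty (λ _ → q ∘ proj₁)
      fibre s (yes p) = card-map (Pointwise.isEquivalence ≋-eq _) id id (p ,_) (λ _ _ q → q) (λ φ (_ , l) → φ , l , λ _ _ → refl)
                      (card-Π h ≋-eq (λ t → L.Labeling s t (k t)) _ (λ t → L.card-labelings s t (k t)))

    -- Adjacency in the branching is adjacency in `G` plus agreement at every common path vertex
    -- `t`. Along the edges of `X` the latter says, for each `t`, that `φ t` is constant wherever
    -- both ends lie in its domain.
    card-hom-lifted : ∀ k → Card (_≋_ ×ᴿ Pointwise _≋_) (Lifted k) (hom (a , X) (size k , branching k))
    card-hom-lifted k = card-map (×-isEquivalence ≋-eq (Pointwise.isEquivalence ≋-eq _)) g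
      (λ p → (λ x → cong (proj₁ ∘ vertex k) (p x)) , λ t x → cong (λ i → proj₂ (vertex k i) t) (p x))
      sound
      (λ _ _ (p , q) x → at-inj (card-vertices k) _ _ (p x , λ t → q t x))
      surj
      (card-hom X (branching k))
      where
      g : (Fin a → Fin (size k)) → (Fin a → Fin h) × (Fin h → Fin a → ℕ)
      g f = (λ x → proj₁ (vertex k (f x))) , λ t x → proj₂ (vertex k (f x)) t
      sound : ∀ {f} → Hom X (branching k) f → Lifted k (g f)
      sound {f} p = (λ i j e → proj₁ (edge i j e)) , λ t → (λ x → at-P (card-vertices k) (f x) t) , λ x y e → proj₂ (edge x y e) t
        where
        edge : ∀ i j → adj X i j ≡ true → Adjacent (vertex k (f i)) (vertex k (f j))
        edge i j e = does⁻ (adjacent? _ _) (p i j e)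
      surj : ∀ y → Lifted k y → ∃[ f ] Hom X (branching k) f × (_≋_ ×ᴿ Pointwise _≋_) (g f) y
      surj (s , φ) (p , l) = (λ x → proj₁ (f x))
        , (λ i j e → dec-true (adjacent? _ _) (Adjacent-resp (E.sym (proj₂ (f i))) (E.sym (proj₂ (f j)))
             (p i j e , λ u → proj₂ (l u) i j e)))
        , (λ x → proj₁ (proj₂ (f x))) , λ t x → proj₂ (proj₂ (f x)) t
        where
        module E = IsEquivalence ≈ᵇ-eq
        f : ∀ x → ∃[ i ] vertex k i ≈ᵇ (s x , λ t → φ t x)
        f x = at-surj (card-vertices k) (s x , λ t → φ t x) (λ t → proj₁ (l t) x)

  -- The lifted pairs are counted in two ways. The exponents `L.c X s` do not depend on `k`, so the
  -- second count is a polynomial.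
  stronglyPolynomial : StronglyPolynomial h (λ k _ → size k , branching k)
  stronglyPolynomial (a , X) = map (λ s → (if does (hom? X G s) then 1ℚ else 0ℚ) , L.c X s) (allFuns a h) , λ k _ →
    trans (cong toℚ (card-unique (×-isEquivalence ≋-eq (Pointwise.isEquivalence ≋-eq _)) (card-hom-lifted X k) (card-lifted X k)))
          (sym (evalPoly-map (λ s → does (hom? X G s)) (L.c X) k (allFuns a h)))

  stronglyPolySub : ∀ I → StronglyPolySub T G I
  stronglyPolySub I = (λ k _ → size k , branching k) , stronglyPolynomial , λ k _ _ → isoBranch k

-- Cycles, paths and levels

least : ∀ {P : ℕ → Set} → (∀ j → Dec (P j)) → ∀ m → P m → ∃[ ℓ ] P ℓ × (∀ j → j < ℓ → ¬ P j)
least {P} P? m pm with P? 0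
... | yes p0 = 0 , p0 , λ _ ()
least {P} P? zero pm | no np0 = ⊥-elim (np0 pm)
least {P} P? (suc m) pm | no np0 with least (P? ∘ suc) m pm
... | ℓ , pℓ , min = suc ℓ , pℓ , λ { zero _ → np0 ; (suc j) (s≤s q) → min j q }

iter-periodic : ∀ {A : Set} (f : A → A) d {x} → iter f d x ≡ x → ∀ m → iter f (m * d) x ≡ x
iter-periodic f d p zero    = refl
iter-periodic f d {x} p (suc m) = trans (iter-+ f d (m * d) x) (trans (cong (iter f (m * d)) p) (iter-periodic f d p m))

-- Going `n` times round the cycle returns to `x`, but takes at least `n` steps, after which the
-- orbit sits at `r`.
cycle-fixed : ∀ {A : Set} (f : A → A) {r x} n d → f r ≡ r → iter f n x ≡ r → iter f (suc d) x ≡ x → x ≡ r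
cycle-fixed f n d fr p q =
  trans (sym (iter-periodic f (suc d) q n)) (iter-fixed-≤ f fr (m≤m*n n (suc d)) p)

-- Among x, f x, …, f^b x two coincide; the earlier of them lies on a cycle, hence equals r.
reaches-in : ∀ {b} (f : Fin b → Fin b) {r x} n → f r ≡ r → iter f n x ≡ r → iter f b x ≡ r
reaches-in {b} f {r} {x} n fr p with pigeonhole (n<1+n b) (λ i → iter f (toℕ i) x)
... | i , j , i<j , e = iter-fixed-≤ f fr (≤-trans (<⇒≤ i<j) (s≤s⁻¹ (toℕ<n j))) fi
  where
  y = iter f (toℕ i) x
  -- The difference of `j` and `i` is written as a successor, the form of a positive period in
  -- `cycle-fixed`.
  cyc : iter f (suc (toℕ j ∸ suc (toℕ i))) y ≡ y
  cyc = trans (sym (iter-+ f (toℕ i) _ x))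
          (trans (cong (λ z → iter f z x) (trans (+-suc (toℕ i) _) (m+[n∸m]≡n i<j))) (sym e))
  ny : iter f n y ≡ r
  ny = trans (sym (iter-+ f (toℕ i) n x)) (iter-fixed-≤ f fr (m≤n+m n (toℕ i)) p)
  fi : iter f (toℕ i) x ≡ r
  fi = cycle-fixed f n (toℕ j ∸ suc (toℕ i)) fr ny cyc

module _ {h} (T : RootedTree h) where

  cycle-root : ∀ d {s} → iter (parent T) (suc d) s ≡ s → s ≡ root T
  cycle-root d {s} = cycle-fixed (parent T) h d (parent-root T) (reaches T s)

  -- Two distinct vertices would lie on a cycle, and then both would be the root.
  InPath-antisym : ∀ {s t} → InPath T s t → InPath T t s → s ≡ t
  InPath-antisym {s} {t} (zero , p) _ = sym p
  InPath-antisym {s} {t} (suc i , p) (j , q) =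
    trans (cycle-root (j + i) (trans (cong (λ z → iter (parent T) z s) (sym (+-suc j i)))
             (trans (iter-+ (parent T) j (suc i) s) (trans (cong (iter (parent T) (suc i)) q) p))))
          (sym (cycle-root (i + j) (trans (iter-+ (parent T) (suc i) j t) (trans (cong (iter (parent T) j) p) q))))

  InPath-linear : ∀ {t u s} → InPath T t s → InPath T u s → InPath T t u ⊎ InPath T u t
  InPath-linear {t} {u} {s} (i , p) (j , q) with ≤-total i j
  ... | inj₁ i≤j = inj₂ (j ∸ i , trans (cong (iter (parent T) (j ∸ i)) (sym p)) (trans (iter-∸ (parent T) i≤j s) q))
  ... | inj₂ j≤i = inj₁ (i ∸ j , trans (cong (iter (parent T) (i ∸ j)) (sym q)) (trans (iter-∸ (parent T) j≤i s) p))

  level : ∀ s → ∃[ ℓ ] IsLevel T s ℓ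
  level s = least (λ j → iter (parent T) j s ≟ root T) h (reaches T s)

  -- If `t` were `d + 1` steps above `s`, it would reach the root within `ℓ ∸ d` steps, fewer than
  -- its level `ℓ + 1`.
  InPath-sameLevel : ∀ {t s ℓ} → InPath T t s → IsLevel T t ℓ → IsLevel T s ℓ → t ≡ s
  InPath-sameLevel {t} {s} {zero}  _           (p , _)   (q , _) = trans p (sym q)
  InPath-sameLevel {t} {s} {suc ℓ} (zero , e)  _         _       = sym e
  InPath-sameLevel {t} {s} {suc ℓ} (suc d , e) (_ , min) (q , _) = ⊥-elim (min (ℓ ∸ d) (s≤s (m∸n≤m ℓ d))
    (trans (cong (iter (parent T) (ℓ ∸ d)) (sym e)) (trans (sym (iter-+ (parent T) (suc d) (ℓ ∸ d) s))
      (iter-fixed-≤ (parent T) (parent-root T) (s≤s (m≤n+m∸n ℓ d)) q))))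

-- Recovering a graph as a branching of its quotient

-- T' and G' are only required to satisfy the defining properties of the quotient, so that they can be
-- taken from an enumeration that contains the quotient up to pointwise equality.
module Quotient {n b} (T : RootedTree n) (H : SGraph n) (sub : SubClos T H)
  (class : Fin n → Fin b) (rep : Fin b → Fin n)
  (class-rep : ∀ i → class (rep i) ≡ i)
  (class-aut : ∀ (α : Aut T H) s → class (Aut.σ α s) ≡ class s)
  (orbit : ∀ {s t} → class s ≡ class t → SameOrbit T H s t)
  (T' : RootedTree b) (G' : SGraph b)
  (class-root : class (root T) ≡ root T')
  (class-parent : ∀ s → class (parent T s) ≡ parent T' (class s))
  (edge⁺ : ∀ {x y} → adj H x y ≡ true → adj G' (class x) (class y) ≡ true)
  (edge⁻ : ∀ {i j} → adj G' i j ≡ true → ∃[ x ] ∃[ y ] class x ≡ i × class y ≡ j × adj H x y ≡ true)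
  where

  private
    p = parent T
    p' = parent T'

  class-iter : ∀ j s → class (iter p j s) ≡ iter p' j (class s)
  class-iter = iter-commute class class-parent

  class-InPath : ∀ {t s} → InPath T t s → InPath T' (class t) (class s)
  class-InPath {t} {s} (j , e) = j , trans (sym (class-iter j s)) (cong class e)

  -- Automorphisms fix the root, so its orbit is a singleton.
  root-class : ∀ {s} → class s ≡ root T' → s ≡ root T
  root-class {s} e = let (α , q) = orbit (trans class-root (sym e)) in trans (sym q) (Aut.σ-root α)

  -- If `t` is properly above `s`, their common class lies on a cycle of `T'`, so it is the class of
  -- the root, which has one element.
  InPath-class-≡ : ∀ {t s} → InPath T t s → class t ≡ class s → t ≡ s
  InPath-class-≡ {t} {s} (zero , e)  _ = sym e
  InPath-class-≡ {t} {s} (suc d , e) q = trans (root-class (trans q cs)) (sym (root-class cs))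
    where
    cs : class s ≡ root T'
    cs = cycle-root T' d (trans (sym (class-iter (suc d) s)) (trans (cong class e) q))

  path-class-inj : ∀ {t u s} → InPath T t s → InPath T u s → class t ≡ class u → t ≡ u
  path-class-inj x y e with InPath-linear T x y
  ... | inj₁ z = InPath-class-≡ z e
  ... | inj₂ z = sym (InPath-class-≡ z (sym e))

  -- By `root-class`, reaching the root in `j` steps can be read off from the class.
  IsLevel-class : ∀ {s t ℓ} → class s ≡ class t → IsLevel T s ℓ → IsLevel T t ℓ
  IsLevel-class {s} {t} {ℓ} e (q , min) = tr ℓ e q , λ j j<ℓ q' → min j j<ℓ (tr j (sym e) q')
    where
    tr : ∀ {s t} j → class s ≡ class t → iter p j s ≡ root T → iter p j t ≡ root T
    tr {s} {t} j e q = root-class (trans (class-iter j t) (trans (cong (iter p' j) (sym e))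
      (trans (sym (class-iter j s)) (trans (cong class q) class-root))))

  InColour-class : ∀ {s t ℓ} → class s ≡ class t → InColour T H s ℓ → InColour T H t ℓ
  InColour-class {s} {t} {ℓ} e c = let (α , q) = orbit e in subst (λ z → InColour T H z ℓ) q (proj₂ (Aut.σ-col α s ℓ) c)

  Child : Fin n → Fin b → Fin n → Set
  Child q i s = p s ≡ q × class s ≡ i

  child? : ∀ q i s → Dec (Child q i s)
  child? q i s = (p s ≟ q) ×-dec (class s ≟ i)

  #children : Fin n → Fin b → ℕ
  #children q i = countDec (child? q i)

  children : ∀ q i → Card _≡_ (Child q i) (#children q i)
  children q i = card-dec (child? q i)

  -- An automorphism taking `q` to `q'` maps children to children and preserves classes.
  #children-orbit : ∀ {q q'} i → class q ≡ class q' → #children q i ≡ #children q' i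
  #children-orbit {q} {q'} i e = card-unique ≡-eq (card-map ≡-eq σ (cong σ)
      (λ {s} (x , y) → trans (σ-par s) (trans (cong σ x) σq) , trans (class-aut α s) y)
      (λ _ _ → σ-inj)
      (λ s (x , y) → σ⁻¹ s
        , (σ-inj (trans (sym (σ-par (σ⁻¹ s))) (trans (cong p (inv₂ s)) (trans x (sym σq))))
          , trans (sym (class-aut α (σ⁻¹ s))) (trans (cong class (inv₂ s)) y))
        , inv₂ s)
      (children q i)) (children q' i)
    where
    α = proj₁ (orbit e)
    open Aut α
    σq : σ q ≡ q'
    σq = proj₂ (orbit e)
    σ-inj : ∀ {s t} → σ s ≡ σ t → s ≡ t
    σ-inj {s} {t} e = trans (sym (inv₁ s)) (trans (cong σ⁻¹ e) (inv₁ t))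

  -- By `#children-orbit` any parent in the right class gives the same number. The root is its own
  -- parent, so its class gets the value 1.
  k : Vecℕ b
  k i = #children (p (rep i)) i

  #children-k : ∀ q i → class q ≡ p' i → #children q i ≡ k i
  #children-k q i e = #children-orbit i (trans e (sym (trans (class-parent (rep i)) (cong p' (class-rep i)))))

  -- Parent and class are parameters, so that siblings of one class are numbered by the same
  -- enumeration. Numbering starts at 1, since 0 marks the coordinates off the path.
  idxIn : ∀ q i s → Child q i s → ℕ
  idxIn q i s c = suc (toℕ (proj₁ (at-surj (children q i) s c)))

  idx : Fin n → ℕ
  idx s = idxIn (p s) (class s) s (refl , refl)

  idx-≡ : ∀ {q i s} (c : Child q i s) → idx s ≡ idxIn q i s c
  idx-≡ (refl , refl) = refl

  idx-bounds : ∀ s → 1 ≤ idx s × idx s ≤ k (class s)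
  idx-bounds s = s≤s z≤n , subst (idx s ≤_) (#children-k (p s) (class s) (class-parent s)) (toℕ<n _)

  k-pos : Pos k
  k-pos i = subst (λ z → 1 ≤ k z) (class-rep i) (let (x , y) = idx-bounds (rep i) in ≤-trans x y)

  idx-inj : ∀ {s t} → p s ≡ p t → class s ≡ class t → idx s ≡ idx t → s ≡ t
  idx-inj {s} {t} ep ec e =
    trans (sym (proj₂ (at-surj C s (ep , ec))))
      (trans (cong (at C) (toℕ-injective (suc-injective (trans (sym (idx-≡ {s = s} (ep , ec))) e))))
             (proj₂ (at-surj C t (refl , refl))))
    where C = children (p t) (class t)

  idx-surj : ∀ q i v → class q ≡ p' i → 1 ≤ v → v ≤ k i → ∃[ s ] Child q i s × idx s ≡ v
  idx-surj q i (suc v) e _ v<k = s , c , trans (idx-≡ {s = s} c) (cong suc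
      (trans (cong toℕ (at-inj C _ _ (proj₂ (at-surj C s c)))) (toℕ-fromℕ< v<#)))
    where
    C = children q i
    v<# : v < #children q i
    v<# = subst (v <_) (sym (#children-k q i e)) v<k
    s = at C (fromℕ< v<#)
    c = at-P C (fromℕ< v<#)

  -- Going down from the root, each vertex is determined by its parent, its class and its number.
  idx-path-inj : ∀ j {s t} → iter p j s ≡ root T → iter p j t ≡ root T → class s ≡ class t →
    (∀ i → idx (iter p i s) ≡ idx (iter p i t)) → s ≡ t
  idx-path-inj zero    es et _ _ = trans es (sym et)
  idx-path-inj (suc j) {s} {t} es et e q = idx-inj
    (idx-path-inj j es et (trans (class-parent s) (trans (cong p' e) (sym (class-parent t)))) (q ∘ suc)) e (q 0)

  idx-path-surj : ∀ j t (φ : Vecℕ b) → iter p' j t ≡ root T' → (∀ i → 1 ≤ φ (iter p' i t) × φ (iter p' i t) ≤ k (iter p' i t)) →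
    ∃[ s ] class s ≡ t × (∀ i → idx (iter p i s) ≡ φ (iter p' i t))
  idx-path-surj zero t φ refl b = root T , class-root ,
      λ i → trans (cong idx (iter-fix p (parent-root T) i)) (trans idx-root (cong φ (sym (iter-fix p' (parent-root T') i))))
    where
    idx-root : idx (root T) ≡ φ (root T')
    -- A vertex found in the root class with the prescribed label must be the root.
    idx-root with idx-surj (root T) (root T') (φ (root T')) (trans class-root (sym (parent-root T'))) (proj₁ (b 0)) (proj₂ (b 0))
    ... | s , (_ , c) , e = trans (cong idx (sym (root-class c))) e
  idx-path-surj (suc j) t φ e b with idx-path-surj j (p' t) φ e (b ∘ suc)
  ... | q , cq , eq with idx-surj q t (φ t) cq (proj₁ (b 0)) (proj₂ (b 0))
  ... | s , (ps , cs) , es = s , cs , λ { zero → es ; (suc i) → trans (cong (idx ∘ iter p i) ps) (eq i) }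

  lab : Fin n → Vecℕ b
  lab s t with inPath? T' t (class s)
  ... | yes (j , _) = idx (iter p j s)
  ... | no _        = 0

  -- The step count found by `inPath?` may differ from the given one, but both lead to path vertices
  -- of one class, which coincide by `path-class-inj`.
  lab-path : ∀ {s u} → InPath T u s → lab s (class u) ≡ idx u
  lab-path {s} {u} x with inPath? T' (class u) (class s)
  ... | yes (j , e) = cong idx (path-class-inj (j , refl) x (trans (class-iter j s) e))
  ... | no nx       = ⊥-elim (nx (class-InPath x))

  lab-iter : ∀ s i → lab s (iter p' i (class s)) ≡ idx (iter p i s)
  lab-iter s i = trans (cong (lab s) (sym (class-iter i s))) (lab-path (i , refl))

  lab-off : ∀ s t → ¬ InPath T' t (class s) → lab s t ≡ 0
  lab-off s t nx with inPath? T' t (class s)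
  ... | yes x = ⊥-elim (nx x)
  ... | no _  = refl

  lab-bounds : ∀ s t → InPath T' t (class s) → 1 ≤ lab s t × lab s t ≤ k t
  lab-bounds s t (i , refl) rewrite lab-iter s i =
    proj₁ (idx-bounds (iter p i s)) , subst (λ z → idx (iter p i s) ≤ k z) (class-iter i s) (proj₂ (idx-bounds (iter p i s)))

  f : Fin n → BVertex T' k
  f s = class s , lab s , lab-bounds s , lab-off s

  lift : ∀ (v : BVertex T' k) → ∃[ s ] class s ≡ proj₁ v × (∀ i → idx (iter p i s) ≡ proj₁ (proj₂ v) (iter p' i (proj₁ v)))
  lift (t , φ , bd , _) = idx-path-surj b t φ (reaches T' t) (λ i → bd (iter p' i t) (i , refl))

  g : BVertex T' k → Fin n
  g v = proj₁ (lift v)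

  f∘g : ∀ v → BEq {T = T'} {k = k} (f (g v)) v
  f∘g v@(t , φ , bd , off) = cs , λ u → go u (inPath? T' u t)
    where
    s = g v
    cs : class s ≡ t
    cs = proj₁ (proj₂ (lift v))
    go : ∀ u → Dec (InPath T' u t) → lab s u ≡ φ u
    go u (yes (i , refl)) = trans (cong (λ z → lab s (iter p' i z)) (sym cs)) (trans (lab-iter s i) (proj₂ (proj₂ (lift v)) i))
    go u (no nx) = trans (lab-off s u (subst (λ z → ¬ InPath T' u z) (sym cs) nx)) (sym (off u nx))

  f-inj : ∀ {s t} → class s ≡ class t → (∀ u → InPath T' u (class t) → lab s u ≡ lab t u) → s ≡ t
  f-inj {s} {t} e q = idx-path-inj n (reaches T s) (reaches T t) e λ i →
    trans (sym (lab-iter s i)) (trans (cong (λ z → lab s (iter p' i z)) e) (trans (q _ (i , refl)) (lab-iter t i)))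

  up⁺ : ∀ {x y} → adj H x y ≡ true → Ancestor T y x → BAdjUp T' G' k (f x) (f y)
  up⁺ {x} {y} a (yx , y≢x) = (class-InPath yx , λ e → y≢x (InPath-class-≡ yx e)) , edge⁺ a , agree
    where
    agree : ∀ u → InPath T' u (class y) → lab y u ≡ lab x u
    agree u (i , refl) = trans (lab-iter y i) (sym (trans (cong (lab x) (sym (class-iter i y))) (lab-path (InPath-trans T (i , refl) yx))))

  -- The edge of `G'` comes from an edge `x₀ y₀` of `H`, with `y₀` above `x₀`. The colour of `x₀`,
  -- hence that of `x`, contains the level of `y₀`. The ancestor of `x` at this level is `y`, so `y`
  -- is the neighbour of `x` that the colour records.
  up⁻ : ∀ {x y} → BAdjUp T' G' k (f x) (f y) → adj H x y ≡ true
  up⁻ {x} {y} ((yx'@(j , ej) , y≢x) , a , agree) with edge⁻ a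
  ... | x₀ , y₀ , cx , cy , a₀ with sub x₀ y₀ a₀
  -- If `x₀` were above `y₀`, the classes of `x` and `y` would be above each other.
  ... | inj₁ (xy , _) = ⊥-elim (y≢x (InPath-antisym T' yx' (subst₂ (InPath T') cx cy (class-InPath xy))))
  ... | inj₂ anc with level T y₀
  ... | ℓ , isℓ with InColour-class cx (y₀ , anc , a₀ , isℓ)
  ... | t , (tx , _) , a' , tℓ = subst (λ z → adj H x z ≡ true) t≡y a'
    where
    -- The vertex `j` steps above `x` has the class and the labels of `y`.
    y'≡y : iter p j x ≡ y
    y'≡y = f-inj (trans (class-iter j x) ej) λ { u (i , refl) → trans (lab-y' i) (sym (agree _ (i , refl))) }
      where
      lab-y' : ∀ i → lab (iter p j x) (iter p' i (class y)) ≡ lab x (iter p' i (class y))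
      lab-y' i = trans (cong (lab _) c) (trans (lab-path (i , refl)) (sym (trans (cong (lab x) c) (lab-path (InPath-trans T (i , refl) (j , refl))))))
        where
        c : iter p' i (class y) ≡ class (iter p i (iter p j x))
        c = sym (trans (class-iter i _) (cong (iter p' i) (trans (class-iter j x) ej)))
    yℓ : IsLevel T y ℓ
    yℓ = IsLevel-class cy isℓ
    t≡y : t ≡ y
    t≡y with InPath-linear T tx (j , y'≡y)
    ... | inj₁ z = InPath-sameLevel T z tℓ yℓ
    ... | inj₂ z = sym (InPath-sameLevel T z yℓ tℓ)

  isoBranch-quotient : IsoBranch (n , H) T' G' k
  isoBranch-quotient = f , g
    , (λ x → let (e , q) = f∘g (f x) in f-inj e (λ u _ → q u))
    , f∘g
    , (λ v w (e , q) → let (e₁ , q₁) = f∘g v ; (e₂ , q₂) = f∘g w in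
         f-inj (trans e₁ (trans e (sym e₂))) λ u _ → trans (q₁ u) (trans (q u) (sym (q₂ u))))
    , λ x y → to x y , from x y
    where
    to : ∀ x y → adj H x y ≡ true → BAdj T' G' k (f x) (f y)
    to x y a with sub x y a
    ... | inj₁ anc = inj₂ (up⁺ (trans (adj-sym H y x) a) anc)
    ... | inj₂ anc = inj₁ (up⁺ a anc)
    from : ∀ x y → BAdj T' G' k (f x) (f y) → adj H x y ≡ true
    from x y (inj₁ u) = up⁻ u
    from x y (inj₂ u) = trans (adj-sym H x y) (up⁻ u)

-- Orbits of tree automorphisms

module _ {n} {T : RootedTree n} {H : SGraph n} where

  SameOrbit-sym : ∀ {s t} → SameOrbit T H s t → SameOrbit T H t s
  SameOrbit-sym {s} (α , e) = record
    { σ = σ⁻¹ ; σ⁻¹ = σ ; inv₁ = inv₂ ; inv₂ = inv₁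
    ; σ-root = trans (cong σ⁻¹ (sym σ-root)) (inv₁ _)
    ; σ-par = λ s → trans (sym (inv₁ _)) (cong σ⁻¹ (trans (sym (σ-par (σ⁻¹ s))) (cong (parent T) (inv₂ s))))
    ; σ-col = λ s ℓ → (λ c → subst (λ z → InColour T H z ℓ) (inv₂ s) (proj₂ (σ-col (σ⁻¹ s) ℓ) c))
                    , (λ c → proj₁ (σ-col (σ⁻¹ s) ℓ) (subst (λ z → InColour T H z ℓ) (sym (inv₂ s)) c))
    } , trans (cong σ⁻¹ (sym e)) (inv₁ s)
    where open Aut α

  SameOrbit-trans : ∀ {s t u} → SameOrbit T H s t → SameOrbit T H t u → SameOrbit T H s u
  SameOrbit-trans (α , e) (β , e') = record
    { σ = B.σ ∘ A.σ ; σ⁻¹ = A.σ⁻¹ ∘ B.σ⁻¹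
    ; inv₁ = λ s → trans (cong A.σ⁻¹ (B.inv₁ _)) (A.inv₁ s)
    ; inv₂ = λ s → trans (cong B.σ (A.inv₂ _)) (B.inv₂ s)
    ; σ-root = trans (cong B.σ A.σ-root) B.σ-root
    ; σ-par = λ s → trans (B.σ-par _) (cong B.σ (A.σ-par s))
    ; σ-col = λ s ℓ → proj₁ (A.σ-col s ℓ) ∘ proj₁ (B.σ-col (A.σ s) ℓ) , proj₂ (B.σ-col (A.σ s) ℓ) ∘ proj₂ (A.σ-col s ℓ)
    } , trans (cong B.σ e) e'
    where
    module A = Aut α
    module B = Aut β

-- Orbit quotients

record Shape : Set where
  constructor shape
  field
    {order} : ℕ
    tree    : RootedTree order
    graph   : SGraph order
    subClos : SubClos tree graph
open Shape

-- Proof components are ignored and functions are compared pointwise, which is as much as a finite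
-- enumeration can match.
data _≈ˢ_ : Shape → Shape → Set where
  alike : ∀ {h} {T T' : RootedTree h} {G G' : SGraph h} {s s'} →
    root T ≡ root T' → parent T ≋ parent T' → (∀ i → adj G i ≋ adj G' i) → shape T G s ≈ˢ shape T' G' s'

quotient : ∀ A {B} → MinBcAtMost A B → Σ Shape λ S → order S ≤ B ×
  (∀ {S'} → S' ≈ˢ S → ∃[ k ] Pos k × IsoBranch A (tree S') (graph S') k)
quotient (n , H) {B} (T , sub , b , (rep , distinct , cover) , b≤B) =
  shape T₀ G₀ sub₀ , b≤B , λ { (alike {T = T'} {G = G'} er ep ea) →
    let open Quotient T H sub class rep class-rep class-aut orbit T' G' (sym er)
               (λ s → trans (class-parent s) (sym (ep _)))
               (λ {x} {y} a → trans (ea _ _) (edge⁺ a))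
               (λ {i} {j} a → edge⁻ (trans (sym (ea i j)) a))
    in k , k-pos , isoBranch-quotient }
  where
  class : Fin n → Fin b
  class s = proj₁ (cover s)

  rep-class : ∀ s → SameOrbit T H (rep (class s)) s
  rep-class s = proj₂ (cover s)

  class-orbit : ∀ {s t} → SameOrbit T H s t → class s ≡ class t
  class-orbit {s} {t} o = distinct _ _ (SameOrbit-trans (rep-class s) (SameOrbit-trans o (SameOrbit-sym (rep-class t))))

  class-rep : ∀ i → class (rep i) ≡ i
  class-rep i = distinct _ _ (rep-class (rep i))

  class-aut : ∀ (α : Aut T H) s → class (Aut.σ α s) ≡ class s
  class-aut α s = sym (class-orbit (α , refl))

  orbit : ∀ {s t} → class s ≡ class t → SameOrbit T H s t
  orbit {s} {t} e = SameOrbit-trans (SameOrbit-sym (rep-class s)) (subst (λ i → SameOrbit T H (rep i) t) (sym e) (rep-class t))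

  parent₀ : Fin b → Fin b
  parent₀ i = class (parent T (rep i))

  -- Automorphisms commute with `parent`, so the class of the parent does not depend on the
  -- representative.
  class-parent : ∀ s → class (parent T s) ≡ parent₀ (class s)
  class-parent s with rep-class s
  ... | α , e = trans (cong (class ∘ parent T) (sym e)) (trans (cong class (Aut.σ-par α _)) (class-aut α _))

  class-iter : ∀ j s → class (iter (parent T) j s) ≡ iter parent₀ j (class s)
  class-iter = iter-commute class class-parent

  parent₀-root : parent₀ (class (root T)) ≡ class (root T)
  parent₀-root = trans (sym (class-parent (root T))) (cong class (parent-root T))

  T₀ : RootedTree b
  T₀ = record
    { root = class (root T)
    ; parent = parent₀
    ; parent-root = parent₀-root
    -- The image of a path of `T` reaches the root in `n` steps, and `reaches-in` lowers this to
    -- `b`.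
    ; reaches = λ i → reaches-in parent₀ n parent₀-root
        (trans (cong (iter parent₀ n) (sym (class-rep i))) (trans (sym (class-iter n (rep i))) (cong class (reaches T (rep i))))) }

  Edge : Fin b → Fin b → Set
  Edge i j = ∃[ x ] ∃[ y ] class x ≡ i × class y ≡ j × adj H x y ≡ true

  edge? : ∀ i j → Dec (Edge i j)
  edge? i j = any? λ x → any? λ y → (class x ≟ i) ×-dec ((class y ≟ j) ×-dec (adj H x y Bool.≟ true))

  Edge-sym : ∀ {i j} → Edge i j → Edge j i
  Edge-sym (x , y , ex , ey , a) = y , x , ey , ex , trans (adj-sym H y x) a

  -- Vertices of one orbit have the same level, so a proper ancestor lies in a different class.
  class-ancestor : ∀ {s t} → Ancestor T s t → Ancestor T₀ (class s) (class t)
  class-ancestor {s} {t} (x@(j , e) , s≢t) = (j , trans (sym (class-iter j t)) (cong class e)) , λ c → s≢t (sameLevel c)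
    where
    sameLevel : class s ≡ class t → s ≡ t
    sameLevel c with level T t
    ... | ℓ , tℓ@(q , min) with orbit (sym c)
    ... | α , eα = InPath-sameLevel T x sℓ tℓ
      where
      iter-σ : ∀ j u → iter (parent T) j (Aut.σ α u) ≡ Aut.σ α (iter (parent T) j u)
      iter-σ j u = sym (iter-commute (Aut.σ α) (λ v → sym (Aut.σ-par α v)) j u)
      sℓ : IsLevel T s ℓ
      sℓ = subst (λ z → IsLevel T z ℓ) eα
        ( trans (iter-σ ℓ t) (trans (cong (Aut.σ α) q) (Aut.σ-root α))
        , λ j j<ℓ r → min j j<ℓ (trans (sym (Aut.inv₁ α _)) (trans (cong (Aut.σ⁻¹ α) (trans (sym (iter-σ j t)) (trans r (sym (Aut.σ-root α))))) (Aut.inv₁ α _))))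

  Edge-ancestor : ∀ {i j} → Edge i j → Ancestor T₀ i j ⊎ Ancestor T₀ j i
  Edge-ancestor (x , y , refl , refl , a) with sub x y a
  ... | inj₁ anc = inj₁ (class-ancestor anc)
  ... | inj₂ anc = inj₂ (class-ancestor anc)

  Edge-irrefl : ∀ i → ¬ Edge i i
  Edge-irrefl i e with Edge-ancestor e
  ... | inj₁ (_ , ne) = ne refl
  ... | inj₂ (_ , ne) = ne refl

  G₀ : SGraph b
  G₀ = record
    { adj = λ i j → does (edge? i j)
    ; sym = λ i j → does-⇔ (mk⇔ Edge-sym Edge-sym) (edge? i j) (edge? j i)
    ; irrefl = λ i → dec-false (edge? i i) (Edge-irrefl i) }

  edge⁺ : ∀ {x y} → adj H x y ≡ true → adj G₀ (class x) (class y) ≡ true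
  edge⁺ {x} {y} a = dec-true (edge? _ _) (x , y , refl , refl , a)

  edge⁻ : ∀ {i j} → adj G₀ i j ≡ true → Edge i j
  edge⁻ {i} {j} = does⁻ (edge? i j)

  sub₀ : SubClos T₀ G₀
  sub₀ i j a = Edge-ancestor (edge⁻ a)

-- Enumeration of shapes

funsOf : ∀ {A : Set} → List A → ∀ n → List (Fin n → A)
funsOf xs zero    = (λ ()) ∷ []
funsOf xs (suc n) = concatMap (λ x → map (x VF.∷_) (funsOf xs n)) xs

-- The relation on values is arbitrary so that the lemma can be iterated: an adjacency matrix is a
-- function with functions as values.
funsOf-complete : ∀ {A : Set} {_≈_ : A → A → Set} {xs} → (∀ a → Any (_≈ a) xs) →
  ∀ n (f : Fin n → A) → Any (λ g → Pointwise _≈_ g f) (funsOf xs n)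
funsOf-complete c zero    f = here (λ ())
funsOf-complete {_≈_ = _≈_} {xs} c (suc n) f = Any.concatMap⁺ (λ x → map (x VF.∷_) (funsOf xs n))
  (Any.map (λ p → Any.map⁺ (Any.map (λ q → λ { zero → p ; (suc i) → q i }) (funsOf-complete c n (f ∘ suc)))) (c (f zero)))

allBools : List Bool
allBools = true ∷ false ∷ []

allBools-complete : ∀ b → Any (_≡ b) allBools
allBools-complete true  = here refl
allBools-complete false = there (here refl)

allFin-complete : ∀ {n} (i : Fin n) → Any (_≡ i) (allFin n)
allFin-complete i = Any.tabulate⁺ i refl

ancestor? : ∀ {h} (T : RootedTree h) s t → Dec (Ancestor T s t)
ancestor? T s t = inPath? T s t ×-dec ¬? (s ≟ t)

subClos? : ∀ {h} (T : RootedTree h) G → Dec (SubClos T G)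
subClos? T G = all? λ s → all? λ t → (adj G s t Bool.≟ true) →-dec (ancestor? T s t ⊎-dec ancestor? T t s)

module _ {h} (r : Fin h) (p : Fin h → Fin h) (a : Fin h → Fin h → Bool) where

  IsTree : Set
  IsTree = p r ≡ r × (∀ s → iter p h s ≡ r)

  IsGraph : Set
  IsGraph = (∀ i j → a i j ≡ a j i) × (∀ i → a i i ≡ false)

  mkTree : IsTree → RootedTree h
  mkTree (pr , re) = record { root = r ; parent = p ; parent-root = pr ; reaches = re }

  mkGraph : IsGraph → SGraph h
  mkGraph (sy , ir) = record { adj = a ; sym = sy ; irrefl = ir }

  isTree? : Dec IsTree
  isTree? = (p r ≟ r) ×-dec all? (λ s → iter p h s ≟ r)

  isGraph? : Dec IsGraph
  isGraph? = all? (λ i → all? (λ j → a i j Bool.≟ a j i)) ×-dec all? (λ i → a i i Bool.≟ false)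

  shapesFrom : List Shape
  shapesFrom with isTree? | isGraph?
  ... | no _  | _     = []
  ... | yes _ | no _  = []
  ... | yes t | yes g with subClos? (mkTree t) (mkGraph g)
  ...   | no _  = []
  ...   | yes s = shape (mkTree t) (mkGraph g) s ∷ []

  -- The tested properties hold for `T` and `G` and pass along pointwise equality, so no test fails.
  shapesFrom-complete : ∀ {T G s} → r ≡ root T → p ≋ parent T → (∀ i → a i ≋ adj G i) → Any (_≈ˢ shape T G s) shapesFrom
  shapesFrom-complete {T} {G} {s} er ep ea with isTree? | isGraph?
  ... | no q  | _     = ⊥-elim (q (trans (ep r) (trans (cong (parent T) er) (trans (parent-root T) (sym er)))
                                  , λ x → trans (iter-commute id ep h x) (trans (reaches T x) (sym er))))
  ... | yes _ | no q  = ⊥-elim (q ((λ i j → trans (ea i j) (trans (adj-sym G i j) (sym (ea j i)))) , λ i → trans (ea i i) (irrefl G i)))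
  ... | yes t | yes g with subClos? (mkTree t) (mkGraph g)
  ...   | yes _ = here (alike er ep ea)
  ...   | no q  = ⊥-elim (q λ x y e → conv (s x y (trans (sym (ea x y)) e)))
    where
    conv₁ : ∀ {x y} → Ancestor T x y → Ancestor (mkTree t) x y
    conv₁ ((j , e) , ne) = (j , trans (iter-commute id ep j _) e) , ne
    conv : ∀ {x y} → Ancestor T x y ⊎ Ancestor T y x → Ancestor (mkTree t) x y ⊎ Ancestor (mkTree t) y x
    conv (inj₁ u) = inj₁ (conv₁ u)
    conv (inj₂ u) = inj₂ (conv₁ u)

shapesOfOrder : ℕ → List Shape
shapesOfOrder h = concatMap (λ r → concatMap (λ p → concatMap (shapesFrom r p)
  (funsOf (funsOf allBools h) h)) (funsOf (allFin h) h)) (allFin h)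

allShapes : ℕ → List Shape
allShapes B = concatMap shapesOfOrder (upTo (suc B))

allShapes-complete : ∀ {B} S → order S ≤ B → Any (_≈ˢ S) (allShapes B)
allShapes-complete {B} S@(shape {h} T G _) h≤B = Any.concatMap⁺ shapesOfOrder
  (Any.map (λ { refl →
    Any.concatMap⁺ _ (Any.map (λ {r} er →
      Any.concatMap⁺ _ (Any.map (λ {p} ep →
        Any.concatMap⁺ (shapesFrom r p) (Any.map (λ {a} ea → shapesFrom-complete r p a er ep ea)
          (funsOf-complete (funsOf-complete allBools-complete h) h (adj G))))
        (funsOf-complete allFin-complete h (parent T))))
      (allFin-complete (root T))) })
    (∈-upTo⁺ (s≤s h≤B)))

-- Canonical representatives

-- The search runs through one value at a time and meets a given witness only up to pointwise
-- equality, hence `resp`.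
anyFun? : ∀ a b (P : (Fin a → Fin b) → Set) → (∀ {f g} → f ≋ g → P f → P g) → (∀ f → Dec (P f)) → Dec (Σ _ P)
anyFun? zero    b P resp P? = map′ (_ ,_) (λ (f , pf) → resp (λ ()) pf) (P? (λ ()))
anyFun? (suc a) b P resp P? = map′ (λ (x , f , pf) → _ , pf)
  (λ (f , pf) → f zero , f ∘ suc , resp (λ { zero → refl ; (suc _) → refl }) pf)
  (any? λ x → anyFun? a b (λ f → P (x VF.∷ f)) (λ q → resp (λ { zero → refl ; (suc i) → q i })) (λ f → P? (x VF.∷ f)))

gIso? : ∀ A B → Dec (GIso A B)
gIso? (n , A) (n' , B) = anyFun? n n' _
  (λ { p (g , q , r , s) → g , (λ x → trans (cong g (sym (p x))) (q x)) , (λ y → trans (sym (p (g y))) (r y))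
                        , λ x y → trans (s x y) (cong₂ (adj B) (p x) (p y)) })
  λ f → anyFun? n' n _
    (λ { p (q , r , s) → (λ x → trans (sym (p (f x))) (q x)) , (λ y → trans (cong f (sym (p y))) (r y)) , s })
    λ g → all? (λ x → g (f x) ≟ x) ×-dec (all? (λ y → f (g y) ≟ y) ×-dec all? (λ x → all? λ y → adj A x y Bool.≟ adj B (f x) (f y)))

GIso-refl : ∀ A → GIso A A
GIso-refl A = id , id , (λ _ → refl) , (λ _ → refl) , λ _ _ → refl

GIso-sym : ∀ {A B} → GIso A B → GIso B A
GIso-sym {A} {B} (f , g , p , q , r) = g , f , q , p , λ x y → trans (cong₂ (adj (proj₂ B)) (sym (q x)) (sym (q y))) (sym (r (g x) (g y)))

GIso-trans : ∀ {A B C} → GIso A B → GIso B C → GIso A C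
GIso-trans (f , g , p , q , r) (f' , g' , p' , q' , r') =
  f' ∘ f , g ∘ g' , (λ x → trans (cong g (p' (f x))) (p x)) , (λ y → trans (cong f' (q (g' y))) (q' y)) , λ x y → trans (r x y) (r' (f x) (f y))

true-ext : ∀ {a b : Bool} → (a ≡ true → b ≡ true) → (b ≡ true → a ≡ true) → a ≡ b
true-ext {true}  {b}     p q = sym (p refl)
true-ext {false} {true}  p q = q refl
true-ext {false} {false} p q = refl

-- Graph isomorphism and branchings

module _ {h} (T : RootedTree h) (G : SGraph h) (k : Vecℕ h) where

  private
    _≈_ : BVertex T k → BVertex T k → Set
    _≈_ = BEq {T = T} {k = k}

  BEq-sym : ∀ v w → v ≈ w → w ≈ v
  BEq-sym _ _ (p , q) = sym p , λ t → sym (q t)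

  BAdjUp-resp : ∀ {v v' w w'} → v ≈ v' → w ≈ w' → BAdjUp T G k v w → BAdjUp T G k v' w'
  BAdjUp-resp (refl , p) (refl , q) (anc , a , r) = anc , a , λ u x → trans (sym (q u)) (trans (r u x) (p u))

  BAdj-resp : ∀ v v' w w' → v ≈ v' → w ≈ w' → BAdj T G k v w → BAdj T G k v' w'
  BAdj-resp v v' w w' p q (inj₁ u) = inj₁ (BAdjUp-resp {v} {v'} {w} {w'} p q u)
  BAdj-resp v v' w w' p q (inj₂ u) = inj₂ (BAdjUp-resp {w} {w'} {v} {v'} q p u)

  GIso-IsoBranch : ∀ {A B} → GIso A B → IsoBranch B T G k → IsoBranch A T G k
  GIso-IsoBranch (φ , φ⁻¹ , p , q , r) (f , g , gf , fg , gc , e) = f ∘ φ , φ⁻¹ ∘ g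
    , (λ x → trans (cong φ⁻¹ (gf (φ x))) (p x))
    , (λ v → subst (λ z → f z ≈ v) (sym (q (g v))) (fg v))
    , (λ v w vw → cong φ⁻¹ (gc v w vw))
    , λ x y → (λ a → proj₁ (e (φ x) (φ y)) (trans (sym (r x y)) a)) , (λ a → trans (r x y) (proj₂ (e (φ x) (φ y)) a))

  IsoBranch-GIso : ∀ {A B} → IsoBranch A T G k → IsoBranch B T G k → GIso A B
  IsoBranch-GIso (f , g , gf , fg , gc , e) (f' , g' , gf' , fg' , gc' , e') = g' ∘ f , g ∘ f'
    , (λ x → trans (gc _ _ (fg' (f x))) (gf x))
    , (λ y → trans (gc' _ _ (fg (f' y))) (gf' y))
    , λ x y → let v = f' (g' (f x)) ; w = f' (g' (f y)) in true-ext
        (λ a → proj₂ (e' _ _) (BAdj-resp (f x) v (f y) w (BEq-sym v (f x) (fg' (f x))) (BEq-sym w (f y) (fg' (f y))) (proj₁ (e x y) a)))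
        (λ a → proj₂ (e x y) (BAdj-resp v (f x) w (f y) (fg' (f x)) (fg' (f y)) (proj₁ (e' _ _) a)))

-- The partition of the family

least-unique : ∀ {P Q : ℕ → Set} → (∀ {j} → P j → Q j) → (∀ {j} → Q j → P j) → ∀ {m n} →
  P m → (∀ j → j < m → ¬ P j) → Q n → (∀ j → j < n → ¬ Q j) → m ≡ n
least-unique pq qp {m} {n} pm minP qn minQ with <-cmp m n
... | tri< m<n _ _ = ⊥-elim (minQ m m<n (pq pm))
... | tri≈ _ e _ = e
... | tri> _ _ n<m = ⊥-elim (minP n n<m (qp qn))

-- The parts are the listed shapes of order at most `B`. Members are identified up to isomorphism,
-- so the last two conditions express that the parts are disjoint and that no member has two indices
-- in its part.
theorem4p2 : (F : ℕ → Graph) →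
    (∃[ B ] ∀ n → MinBcAtMost (F n) B) →
    ∃[ m ] Σ (Fin m → ℕ) λ h →
    Σ ((ℓ : Fin m) → RootedTree (h ℓ)) λ T →
    Σ ((ℓ : Fin m) → SGraph (h ℓ)) λ G →
    Σ ((ℓ : Fin m) → Vecℕ (h ℓ) → Set) λ I →
    (∀ ℓ → SubClos (T ℓ) (G ℓ)) ×
    (∀ ℓ k → I ℓ k → Pos k) ×
    (∀ ℓ → StronglyPolySub (T ℓ) (G ℓ) (I ℓ)) ×
    (∀ n → Σ (Fin m) λ ℓ → Σ (Vecℕ (h ℓ)) λ k → I ℓ k × IsoBranch (F n) (T ℓ) (G ℓ) k) ×
    (∀ ℓ k → I ℓ k → ∃[ n ] IsoBranch (F n) (T ℓ) (G ℓ) k) ×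
    (∀ n n' ℓ ℓ' k k' → I ℓ k → I ℓ' k' →
    IsoBranch (F n) (T ℓ) (G ℓ) k → IsoBranch (F n') (T ℓ') (G ℓ') k' →
    GIso (F n) (F n') → ℓ ≡ ℓ') ×
    (∀ n n' ℓ k k' → I ℓ k → I ℓ k' →
    IsoBranch (F n) (T ℓ) (G ℓ) k → IsoBranch (F n') (T ℓ) (G ℓ) k' →
    GIso (F n) (F n') → ∀ i → k i ≡ k' i)
theorem4p2 F (B , bc) = m , h , T , G , I
  , (λ ℓ → subClos (S ℓ))
  , (λ ℓ k Ik → proj₁ (I-branch Ik))
  , (λ ℓ → Branching.stronglyPolySub (T ℓ) (G ℓ) (subClos (S ℓ)) (I ℓ))
  -- The index of `F n` is that of the first isomorphic member, whose branching is carried over by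
  -- the isomorphism.
  , (λ n → let (ℓ , k) = code (canon n) in ℓ , k , (n , refl) ,
      GIso-IsoBranch (T ℓ) (G ℓ) k {F n} {F (canon n)}
        (GIso-sym {F (canon n)} {F n} (canon-iso n)) (proj₂ (code-branch (canon n))))
  , (λ ℓ k Ik → canon (proj₁ Ik) , proj₂ (I-branch Ik))
  , (λ n n' ℓ ℓ' k k' Ik Ik' b b' iso → cong proj₁ (unique Ik Ik' b b' iso))
  , (λ n n' ℓ k k' Ik Ik' b b' iso i → same-k (unique Ik Ik' b b' iso) i)
  where
  shapes = allShapes B
  m = length shapes
  S : Fin m → Shape
  S = lookup shapes
  h : Fin m → ℕ
  h ℓ = order (S ℓ)
  T : ∀ ℓ → RootedTree (h ℓ)
  T ℓ = tree (S ℓ)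
  G : ∀ ℓ → SGraph (h ℓ)
  G ℓ = graph (S ℓ)

  Code : Set
  Code = Σ (Fin m) λ ℓ → Vecℕ (h ℓ)

  Branch : Graph → Code → Set
  Branch A (ℓ , k) = Pos k × IsoBranch A (T ℓ) (G ℓ) k

  encode : ∀ n → Σ Code (Branch (F n))
  encode n with quotient (F n) (bc n)
  -- The listed shape is only alike to `S₀`, so the branching is taken for the listed one.
  ... | S₀ , le , iso with allShapes-complete S₀ le
  ... | found with iso (Any.lookup-index found)
  ... | k , pos , br = (Any.index found , k) , pos , br

  code : ℕ → Code
  code n = proj₁ (encode n)

  code-branch : ∀ n → Branch (F n) (code n)
  code-branch n = proj₂ (encode n)

  canonical : ∀ n → ∃[ c ] GIso (F c) (F n) × (∀ j → j < c → ¬ GIso (F j) (F n))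
  canonical n = least (λ j → gIso? (F j) (F n)) n (GIso-refl (F n))

  canon : ℕ → ℕ
  canon n = proj₁ (canonical n)

  canon-iso : ∀ n → GIso (F (canon n)) (F n)
  canon-iso n = proj₁ (proj₂ (canonical n))

  canon-cong : ∀ {n n'} → GIso (F n) (F n') → canon n ≡ canon n'
  canon-cong {n} {n'} iso = least-unique
    (λ {j} p → GIso-trans {F j} {F n} {F n'} p iso) (λ {j} p → GIso-trans {F j} {F n'} {F n} p (GIso-sym {F n} {F n'} iso))
    (canon-iso n) (proj₂ (proj₂ (canonical n))) (canon-iso n') (proj₂ (proj₂ (canonical n')))

  -- Only codes of canonical members are indices, so each isomorphism class has a single index.
  I : ∀ ℓ → Vecℕ (h ℓ) → Set
  I ℓ k = ∃[ n ] (ℓ , k) ≡ code (canon n)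

  I-branch : ∀ {ℓ k} ((n , _) : I ℓ k) → Branch (F (canon n)) (ℓ , k)
  I-branch (n , e) = subst (Branch (F (canon n))) (sym e) (code-branch (canon n))

  I-iso : ∀ {n ℓ k} ((n₀ , _) : I ℓ k) → IsoBranch (F n) (T ℓ) (G ℓ) k → GIso (F n₀) (F n)
  I-iso {n} {ℓ} {k} Ik@(n₀ , _) b = GIso-trans {F n₀} {F (canon n₀)} {F n} (GIso-sym {F (canon n₀)} {F n₀} (canon-iso n₀))
    (IsoBranch-GIso (T ℓ) (G ℓ) k {F (canon n₀)} {F n} (proj₂ (I-branch Ik)) b)

  -- The indices are codes of the canonical members for `n₀` and `n₀'`. Through the branchings
  -- `F n₀` and `F n₀'` are isomorphic, so these canonical members coincide.
  unique : ∀ {n n' ℓ ℓ' k k'} → I ℓ k → I ℓ' k' → IsoBranch (F n) (T ℓ) (G ℓ) k → IsoBranch (F n') (T ℓ') (G ℓ') k' →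
    GIso (F n) (F n') → (ℓ , k) ≡ (ℓ' , k')
  unique {n} {n'} Ik@(n₀ , e) Ik'@(n₀' , e') b b' iso = trans e (trans (cong code (canon-cong
    (GIso-trans {F n₀} {F n} {F n₀'} (I-iso Ik b) (GIso-trans {F n} {F n'} {F n₀'} iso (GIso-sym {F n₀'} {F n'} (I-iso Ik' b')))))) (sym e'))

  same-k : ∀ {ℓ k k'} → _≡_ {A = Code} (ℓ , k) (ℓ , k') → ∀ i → k i ≡ k' i
  same-k refl i = refl
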